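{- Let $\mathbb F_2$ be the free group with free generators $a,b$. Let $\alpha,\beta:\mathbb Z\to\mathbb Z$ be bounded odd functions such that $\alpha(n)\neq0$ for all but finitely many $n\in\mathbb Z$, and let $f:\mathbb F_2\to\mathbb Z$ be given by $$f(a^{n_1}b^{m_1}\cdots a^{n_k}b^{m_k}):=\sum_{i=1}^k\bigl(\alpha(n_i)+\beta(m_i)\bigr),$$ where $n_i\neq0$ for $1<i\leq k$ and $m_i\neq0$ for $1\leq i<k$. Let $M$ be the two-sorted structure with sorts the groups $(\mathbb F_2,\cdot)$ and $(\mathbb Z,+)$ together with the function $f$ (or any expansion of this structure), let $M^*\succ M$ be a monster model with corresponding sorts $\mathbb F_2^*,\mathbb Z^*$ and function $f^*:\mathbb F_2^*\to\mathbb Z^*$, let $X\subseteq\mathbb F_2^*\times\mathbb Z^*$ be the graph of $f^*$ (which is a $\emptyset$-definable approximate subgroup), and let $H:=\langle X\rangle$ be the subgroup of $\mathbb F_2^*\times\mathbb Z^*$ generated by $X$. Then $H^{00}_\emptyset$ does not exist.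
   Context: A monster model is $\kappa$-saturated and strongly $\kappa$-homogeneous for a sufficiently large cardinal $\kappa$; bounded means of cardinality $<\kappa$. An approximate subgroup of a group is a symmetric subset $X$ such that $X^2=XX$ is contained in finitely many left translates of $X$. If $H$ contains a $\emptyset$-type-definable subgroup of bounded index in $H$, then there is a smallest such subgroup, denoted $H^{00}_\emptyset$; thus "$H^{00}_\emptyset$ does not exist" means that $H$ contains no $\emptyset$-type-definable subgroup of bounded index. -}

module Defs where

open import Level using (Level; _⊔_; suc; 0ℓ)
open import Algebra.Bundles.Raw using (RawMonoid)
import Algebra.Construct.DirectProduct as DirectProduct
open import Data.Empty using (⊥)
open import Data.Fin.Base using (zero; fromℕ)
open import Data.Integer.Base as ℤ using (ℤ; +_; -[1+_]; 0ℤ; ∣_∣)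
open import Data.List.Base as List using (List; []; _∷_; _++_)
open import Data.List.Membership.Propositional using (_∈_; _∉_)
open import Data.List.Relation.Unary.All as All using (All; []; _∷_)
open import Data.List.Relation.Unary.All.Properties using (++⁺)
open import Data.List.Relation.Unary.Any using (Any)
open import Data.List.Relation.Unary.Linked as Linked using (Linked; []; [-]; _∷_)
open import Data.Nat.Base as ℕ using (ℕ)
open import Data.Product using (Σ; Σ-syntax; ∃-syntax; _×_; _,_)
open import Data.Sign.Base using (Sign; opposite)
import Data.Sign.Properties as Sign
open import Data.Sum.Base using (_⊎_; inj₁; inj₂)
open import Data.Vec.Functional as Vector using (Vector)
open import Function.Bundles using (_↣_; _↔_; _⇔_; Inverse)
open import Relation.Binary.Definitions using (DecidableEquality)
open import Relation.Binary.PropositionalEquality using (_≡_; _≢_; refl)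
open import Relation.Nullary using (¬_; yes; no)
open import Relation.Unary using (Pred; _⊆_; _≐_)

private
  variable
    c d ℓ ℓ′ : Level

-- A cardinal is represented by a type of that size.
infix 4 _≺_
_≺_ : Set c → Set d → Set (c ⊔ d)
A ≺ B = (A ↣ B) × ¬ (B ↣ A)

record Language (S : Set) ℓ : Set (suc ℓ) where
  field
    Fun : List S → S → Set ℓ
    Rel : List S → Set ℓ

module _ {S : Set} where

  record Interpretation (L : Language S ℓ) (A : S → Set c) : Set (ℓ ⊔ suc c) where
    open Language L
    field
      fun : ∀ {ss s} → Fun ss s → All A ss → A s
      rel : ∀ {ss} → Rel ss → All A ss → Set c

  record Structure (L : Language S ℓ) c : Set (ℓ ⊔ suc c) where
    field
      Carrier        : S → Set c
      interpretation : Interpretation L Carrier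
    open Interpretation interpretation public

  infixl 6 _∪ᴸ_ _∪ᴵ_

  _∪ᴸ_ : Language S ℓ → Language S ℓ′ → Language S (ℓ ⊔ ℓ′)
  L ∪ᴸ L′ = record
    { Fun = λ ss s → Language.Fun L ss s ⊎ Language.Fun L′ ss s
    ; Rel = λ ss → Language.Rel L ss ⊎ Language.Rel L′ ss
    }

  _∪ᴵ_ : {L : Language S ℓ} {L′ : Language S ℓ′} {A : S → Set c} →
         Interpretation L A → Interpretation L′ A → Interpretation (L ∪ᴸ L′) A
  I ∪ᴵ J = record
    { fun = λ { (inj₁ F) → Interpretation.fun I F ; (inj₂ F) → Interpretation.fun J F }
    ; rel = λ { (inj₁ R) → Interpretation.rel I R ; (inj₂ R) → Interpretation.rel J R }
    }

  module _ (L : Language S ℓ) where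
    open Language L

    data Term (Γ : List S) : S → Set ℓ where
      var : ∀ {s} → s ∈ Γ → Term Γ s
      app : ∀ {ss s} → Fun ss s → All (Term Γ) ss → Term Γ s

    -- `all` and `ex` bind the first variable of the context.
    data Formula (Γ : List S) : Set ℓ where
      eq          : ∀ {s} → Term Γ s → Term Γ s → Formula Γ
      atom        : ∀ {ss} → Rel ss → All (Term Γ) ss → Formula Γ
      bot         : Formula Γ
      and or impl : Formula Γ → Formula Γ → Formula Γ
      all ex      : (s : S) → Formula (s ∷ Γ) → Formula Γ

  module _ {L : Language S ℓ} (M : Structure L c) where
    open Structure M

    mutual
      ⟦_⟧ : ∀ {Γ s} → Term L Γ s → All Carrier Γ → Carrier s
      ⟦ var x ⟧    ρ = All.lookup ρ x
      ⟦ app F ts ⟧ ρ = fun F (⟦ ts ⟧* ρ)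

      ⟦_⟧* : ∀ {Γ ss} → All (Term L Γ) ss → All Carrier Γ → All Carrier ss
      ⟦ [] ⟧*     ρ = []
      ⟦ t ∷ ts ⟧* ρ = ⟦ t ⟧ ρ ∷ ⟦ ts ⟧* ρ

    Sat : ∀ {Γ} → Formula L Γ → All Carrier Γ → Set c
    Sat (eq t u)    ρ = ⟦ t ⟧ ρ ≡ ⟦ u ⟧ ρ
    Sat (atom R ts) ρ = rel R (⟦ ts ⟧* ρ)
    Sat bot         ρ = Level.Lift _ ⊥
    Sat (and φ ψ)   ρ = Sat φ ρ × Sat ψ ρ
    Sat (or φ ψ)    ρ = Sat φ ρ ⊎ Sat ψ ρ
    Sat (impl φ ψ)  ρ = Sat φ ρ → Sat ψ ρ
    Sat (all s φ)   ρ = (x : Carrier s) → Sat φ (x ∷ ρ)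
    Sat (ex s φ)    ρ = Σ[ x ∈ Carrier s ] Sat φ (x ∷ ρ)

    ∅-Definable : ∀ {Γ} → Pred (All Carrier Γ) c → Set (ℓ ⊔ c)
    ∅-Definable {Γ} D = Σ[ φ ∈ Formula L Γ ] (D ≐ Sat φ)

  -- M ≼ N up to identifying M with its image in N.
  record _≼_ {L : Language S ℓ} (M : Structure L c) (N : Structure L d) :
             Set (ℓ ⊔ c ⊔ d) where
    private
      module M = Structure M
      module N = Structure N
    field
      embed      : ∀ {s} → M.Carrier s → N.Carrier s
      elementary : ∀ {Γ} (φ : Formula L Γ) (ρ : All M.Carrier Γ) →
                   Sat M φ ρ ⇔ Sat N φ (All.map embed ρ)

  record Automorphism {L : Language S ℓ} (M : Structure L c) : Set (ℓ ⊔ c) where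
    open Language L
    open Structure M
    field
      bijection : ∀ s → Carrier s ↔ Carrier s
    to : ∀ {s} → Carrier s → Carrier s
    to {s} = Inverse.to (bijection s)
    field
      fun-homo : ∀ {ss s} (F : Fun ss s) (xs : All Carrier ss) →
                 to (fun F xs) ≡ fun F (All.map to xs)
      rel-homo : ∀ {ss} (R : Rel ss) (xs : All Carrier ss) →
                 rel R xs ⇔ rel R (All.map to xs)

  -- Small sets of parameters are given as families A : ∀ {s} → I s → Carrier s
  -- indexed by sorted sets I with Σ S I ≺ κ.

  module _ {L : Language S ℓ} (M : Structure L ℓ) where
    open Structure M

    -- Formulas with free variables Δ and parameters named by I.
    FormulaOver : (I : S → Set ℓ) → List S → Set ℓ
    FormulaOver I Δ = Σ[ Γ ∈ List S ] Formula L (Δ ++ Γ) × All I Γ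

    SatOver : ∀ {I Δ} → (∀ {s} → I s → Carrier s) →
              All Carrier Δ → FormulaOver I Δ → Set ℓ
    SatOver A ρ (Γ , φ , is) = Sat M φ (++⁺ ρ (All.map A is))

    Saturated : Set ℓ → Set (suc ℓ)
    Saturated κ =
      (I : S → Set ℓ) → Σ S I ≺ κ → (A : ∀ {s} → I s → Carrier s) →
      (Δ : List S) (p : Pred (FormulaOver I Δ) ℓ) →
      (∀ φs → All p φs → Σ[ ρ ∈ All Carrier Δ ] All (SatOver A ρ) φs) →
      Σ[ ρ ∈ All Carrier Δ ] (∀ φ → p φ → SatOver A ρ φ)

    StronglyHomogeneous : Set ℓ → Set (suc ℓ)
    StronglyHomogeneous κ =
      (I : S → Set ℓ) → Σ S I ≺ κ → (A B : ∀ {s} → I s → Carrier s) →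
      (∀ {Γ} (φ : Formula L Γ) (is : All I Γ) →
        Sat M φ (All.map A is) ⇔ Sat M φ (All.map B is)) →
      Σ[ σ ∈ Automorphism M ] (∀ {s} (i : I s) → Automorphism.to σ (A i) ≡ B i)

    -- There are |L| + ℵ₀ formulas, so `large` says that κ > |L| + ℵ₀.
    record IsMonster (κ : Set ℓ) : Set (suc ℓ) where
      field
        large       : (Σ[ Γ ∈ List S ] Formula L Γ) ≺ κ
        saturated   : Saturated κ
        homogeneous : StronglyHomogeneous κ

    ∅-TypeDefinable : ∀ {Γ} → Pred (All Carrier Γ) ℓ → Set (suc ℓ)
    ∅-TypeDefinable {Γ} D =
      Σ[ Φ ∈ Pred (Formula L Γ) ℓ ] (D ≐ λ ρ → ∀ φ → Φ φ → Sat M φ ρ)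

-- G is meant to be a group. Only the multiplication and the unit are
-- given; inverses, being unique, are described by their defining equations.

module GroupSubsets (G : RawMonoid ℓ ℓ) where
  open RawMonoid G

  _IsInverseOf_ : Carrier → Carrier → Set ℓ
  h IsInverseOf g = (g ∙ h ≈ ε) × (h ∙ g ≈ ε)

  Symmetric : Pred Carrier ℓ → Set ℓ
  Symmetric X = ∀ {g h} → X g → h IsInverseOf g → X h

  record IsSubgroup (K : Pred Carrier ℓ) : Set ℓ where
    field
      ε-closed  : K ε
      ∙-closed  : ∀ {g h} → K g → K h → K (g ∙ h)
      ⁻¹-closed : Symmetric K

  data ⟨_⟩ (X : Pred Carrier ℓ) : Pred Carrier ℓ where
    incl    : ∀ {g} → X g → ⟨ X ⟩ g
    unit    : ⟨ X ⟩ ε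
    product : ∀ {g h} → ⟨ X ⟩ g → ⟨ X ⟩ h → ⟨ X ⟩ (g ∙ h)
    inverse : ∀ {g h} → ⟨ X ⟩ g → h IsInverseOf g → ⟨ X ⟩ h

  -- X ∙ X ⊆ c₁ ∙ X ∪ … ∪ cₙ ∙ X for some c₁, …, cₙ in the group.
  IsApproximateSubgroup : Pred Carrier ℓ → Set ℓ
  IsApproximateSubgroup X = Symmetric X ×
    (Σ[ cs ∈ List Carrier ] (∀ {g h} → X g → X h →
      Any (λ c → ∃[ x ] X x × (g ∙ h ≈ c ∙ x)) cs))

  -- K has fewer than κ left cosets in H.
  BoundedIndex : Set ℓ → (H K : Pred Carrier ℓ) → Set (suc ℓ)
  BoundedIndex κ H K =
    Σ[ I ∈ Set ℓ ] (I ≺ κ) × (Σ[ r ∈ (I → Carrier) ]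
      (∀ i → H (r i)) × (∀ {g} → H g → ∃[ i ] ∃[ k ] K k × (g ≈ r i ∙ k)))

-- 𝔽₂ is realised as the group of reduced words in the letters a, b and
-- their inverses.

data Generator : Set where
  a b : Generator

_≟ᴳ_ : DecidableEquality Generator
a ≟ᴳ a = yes refl
a ≟ᴳ b = no λ ()
b ≟ᴳ a = no λ ()
b ≟ᴳ b = yes refl

record Letter : Set where
  constructor _^±_
  field
    generator : Generator
    sign      : Sign

_≟_ : DecidableEquality Letter
(x ^± s) ≟ (y ^± t) with x ≟ᴳ y | s Sign.≟ t
... | yes refl | yes refl = yes refl
... | yes _    | no s≢t   = no λ { refl → s≢t refl }
... | no x≢y   | _        = no λ { refl → x≢y refl }

flip : Letter → Letter
flip (x ^± s) = x ^± opposite s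

Reduced : List Letter → Set
Reduced = Linked (λ x y → y ≢ flip x)

-- Reducedness is irrelevant, so _≡_ on 𝔽₂ is equality of words.
record 𝔽₂ : Set where
  constructor ⟪_,_⟫
  field
    word     : List Letter
    .reduced : Reduced word

open 𝔽₂ public

cancelCons : Letter → List Letter → List Letter
cancelCons x []       = x ∷ []
cancelCons x (y ∷ ys) with y ≟ flip x
... | yes _ = ys
... | no  _ = x ∷ y ∷ ys

cancelCons-reduced : ∀ x {ys} → Reduced ys → Reduced (cancelCons x ys)
cancelCons-reduced x {[]}     _ = [-]
cancelCons-reduced x {y ∷ ys} r with y ≟ flip x
... | yes _   = Linked.tail r
... | no y≢x⁻ = y≢x⁻ ∷ r

_◃_ : Letter → 𝔽₂ → 𝔽₂
x ◃ ⟪ ys , r ⟫ = ⟪ cancelCons x ys , cancelCons-reduced x r ⟫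

1𝔽 : 𝔽₂
1𝔽 = ⟪ [] , [] ⟫

infixl 7 _·_
_·_ : 𝔽₂ → 𝔽₂ → 𝔽₂
u · v = List.foldr _◃_ v (word u)

infix 8 _^_
_^_ : Generator → ℤ → 𝔽₂
x ^ (+ n)    = List.foldr _◃_ 1𝔽 (List.replicate n (x ^± Sign.+))
x ^ -[1+ n ] = List.foldr _◃_ 1𝔽 (List.replicate (ℕ.suc n) (x ^± Sign.-))

Bounded : (ℤ → ℤ) → Set
Bounded α = ∃[ B ] (∀ n → ∣ α n ∣ ℕ.≤ B)

Odd : (ℤ → ℤ) → Set
Odd α = ∀ n → α (ℤ.- n) ≡ ℤ.- α n

AlmostNowhereZero : (ℤ → ℤ) → Set
AlmostNowhereZero α = Σ[ ns ∈ List ℤ ] (∀ n → n ∉ ns → α n ≢ 0ℤ)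

-- With k = suc j ≥ 1 syllable pairs. As every element of 𝔽₂ has exactly one
-- expression of this form, the condition determines f.
GivenBy : (α β : ℤ → ℤ) → (𝔽₂ → ℤ) → Set
GivenBy α β f = ∀ j (n m : Vector ℤ (ℕ.suc j)) →
  (∀ i → i ≢ zero → n i ≢ 0ℤ) →
  (∀ i → i ≢ fromℕ j → m i ≢ 0ℤ) →
  f (Vector.foldr _·_ 1𝔽 (λ i → a ^ n i · b ^ m i)) ≡
  Vector.foldr ℤ._+_ 0ℤ (λ i → α (n i) ℤ.+ β (m i))

data Sort : Set where
  𝐅 𝐙 : Sort

data BaseFun : List Sort → Sort → Set where
  mul : BaseFun (𝐅 ∷ 𝐅 ∷ []) 𝐅
  add : BaseFun (𝐙 ∷ 𝐙 ∷ []) 𝐙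
  fn  : BaseFun (𝐅 ∷ []) 𝐙

baseLanguage : Language Sort 0ℓ
baseLanguage = record { Fun = BaseFun ; Rel = λ _ → ⊥ }

⟦Sort⟧ : Sort → Set
⟦Sort⟧ 𝐅 = 𝔽₂
⟦Sort⟧ 𝐙 = ℤ

baseInterpretation : (𝔽₂ → ℤ) → Interpretation baseLanguage ⟦Sort⟧
baseInterpretation f = record
  { fun = λ { mul (u ∷ v ∷ []) → u · v
            ; add (x ∷ y ∷ []) → x ℤ.+ y
            ; fn  (u ∷ [])     → f u }
  ; rel = λ ()
  }

expansion : (f : 𝔽₂ → ℤ) {L : Language Sort ℓ} → Interpretation L ⟦Sort⟧ →
            Structure (baseLanguage ∪ᴸ L) 0ℓ
expansion f E = record
  { Carrier        = ⟦Sort⟧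
  ; interpretation = baseInterpretation f ∪ᴵ E
  }

module Extension {f : 𝔽₂ → ℤ} {L : Language Sort ℓ} {E : Interpretation L ⟦Sort⟧}
                 (M* : Structure (baseLanguage ∪ᴸ L) ℓ) (M≼M* : expansion f E ≼ M*) where
  open Structure M*
  open _≼_ M≼M*

  f* : Carrier 𝐅 → Carrier 𝐙
  f* u = fun (inj₁ fn) (u ∷ [])

  𝔽₂* ℤ* : RawMonoid ℓ ℓ
  𝔽₂* = record
    { _≈_ = _≡_
    ; _∙_ = λ u v → fun (inj₁ mul) (u ∷ v ∷ [])
    ; ε   = embed 1𝔽
    }
  ℤ* = record
    { _≈_ = _≡_
    ; _∙_ = λ x y → fun (inj₁ add) (x ∷ y ∷ [])
    ; ε   = embed 0ℤ
    }

  𝔽₂*×ℤ* : RawMonoid ℓ ℓ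
  𝔽₂*×ℤ* = DirectProduct.rawMonoid 𝔽₂* ℤ*

  open GroupSubsets 𝔽₂*×ℤ* public

  Subset : Set (suc ℓ)
  Subset = Pred (Carrier 𝐅 × Carrier 𝐙) ℓ

  asTuples : Subset → Pred (All Carrier (𝐅 ∷ 𝐙 ∷ [])) ℓ
  asTuples D (u ∷ x ∷ []) = D (u , x)

  X : Subset
  X (u , x) = f* u ≡ x

  H : Subset
  H = ⟨ X ⟩

  -- H⁰⁰_∅ exists iff H contains a ∅-type-definable subgroup of bounded index.
  H⁰⁰-Exists : Set ℓ → Set (suc ℓ)
  H⁰⁰-Exists κ = Σ[ K ∈ Subset ]
    ∅-TypeDefinable M* (asTuples K) × IsSubgroup K × (K ⊆ H) × BoundedIndex κ H K

module Submission where

-- Writing f(x) for the sum over the maximal runs of a word shows that f is odd and a quasimorphism,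
-- so H lies in the set of pairs (u, f*(u) + k) with k a standard integer. If K ≤ H is type-definable,
-- then by compactness |k| ≤ N on some definable D₀ ⊇ K, and there are definable Dᵢ ⊇ K with
-- Dᵢ₊₁⁻¹ Dᵢ₊₁ ⊆ Dᵢ. If K also has bounded index, then finitely many translates of Dᵢ₊₁ cover 𝔽₂*
-- and, by the pigeonhole principle, Dᵢ contains standard pairs (a^p, x) and (b^q, y) with p, q > 0
-- and p arbitrarily large. Let i be large and n = 2^i. The n-th powers of (a^p, x),
-- (a^p b^q, x + y) and (a^p b^-q, x - y) are still in D₀, where f takes the bounded value α(n p)
-- and the values n (α(p) + β(q)) and n (α(p) - β(q)). Hence x = 0, x + y = α(p) + β(q) and
-- x - y = α(p) - β(q), so that α(p) = 0: a contradiction for large p.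

open import Level using (Level; 0ℓ; Lift; lift; lower)
open import Algebra.Bundles using (Group; AbelianGroup)
import Algebra.Properties.Group as GroupProperties
import Algebra.Properties.Monoid.Mult as Mult
open import Axiom.ExcludedMiddle using (ExcludedMiddle)
open import Data.Empty using (⊥)
open import Data.Fin.Base as Fin using (fromℕ)
import Data.Fin.Properties as Fin
open import Data.Integer.Base as ℤ using (ℤ; +_; -[1+_]; 0ℤ; ∣_∣)
import Data.Integer.Properties as ℤ
import Data.Integer.Tactic.RingSolver as ℤ-Solver
open import Data.List.Base as List using (List; []; _∷_; _++_; _∷ʳ_; length; replicate; reverse; map)
open import Data.List.Extrema.Nat using (max; xs≤max)
open import Data.List.Membership.Propositional using (_∈_; find)
open import Data.List.Membership.Propositional.Properties using (∈-map⁺)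
open import Data.List.Properties
open import Data.List.Relation.Binary.Permutation.Propositional using (↭-sym)
open import Data.List.Relation.Binary.Permutation.Propositional.Properties using (All-resp-↭; ↭-reverse)
open import Data.List.Relation.Unary.All as All using (All; []; _∷_)
import Data.List.Relation.Unary.All.Properties as All
open import Data.List.Relation.Unary.Any as Any using (Any; here; there; satisfied)
import Data.List.Relation.Unary.Any.Properties as Any
open import Data.List.Relation.Unary.Linked as Linked using ([]; [-]; _∷_)
open import Data.Nat.Base as ℕ using (ℕ; zero; suc)
import Data.Nat.Properties as ℕ
open import Data.Product using (Σ; _×_; _,_; proj₁; proj₂; ∃-syntax; Σ-syntax)
open import Data.Sign.Base as Sign using (Sign; opposite)
open import Data.Sum.Base as Sum using (_⊎_; inj₁; inj₂)
open import Data.Unit.Base using (⊤; tt)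
open import Data.Vec.Functional as Vector using (Vector)
open import Function.Base using (_∘_; id)
open import Function.Bundles using (_⇔_; mk⇔; Equivalence; _↣_; mk↣)
open import Function.Construct.Composition using (_↣-∘_)
open import Relation.Binary.PropositionalEquality
open import Relation.Nullary using (¬_; yes; no; contradiction; ¬?; recompute)
open import Relation.Nullary.Decidable using (decidable-stable)
open import Relation.Unary using (Pred; _⊆_; _≐_)
open import Defs

-- The free group

flip-involutive : ∀ x → flip (flip x) ≡ x
flip-involutive (g ^± Sign.+) = refl
flip-involutive (g ^± Sign.-) = refl

x≢flip : ∀ x → x ≢ flip x
x≢flip (g ^± Sign.+) ()
x≢flip (g ^± Sign.-) ()

cancelCons-flip : ∀ x ys → cancelCons x (flip x ∷ ys) ≡ ys
cancelCons-flip x ys with flip x ≟ flip x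
... | yes _ = refl
... | no ≢ = contradiction refl ≢

cancelCons-≡∷ : ∀ x {ys} → Reduced (x ∷ ys) → cancelCons x ys ≡ x ∷ ys
cancelCons-≡∷ x {[]} _ = refl
cancelCons-≡∷ x {y ∷ ys} (y≢x⁻ ∷ _) with y ≟ flip x
... | yes y≡x⁻ = contradiction y≡x⁻ y≢x⁻
... | no _ = refl

cancelCons-cancel : ∀ x {ys} → Reduced ys → cancelCons x (cancelCons (flip x) ys) ≡ ys
cancelCons-cancel x {[]} _ = cancelCons-flip x []
cancelCons-cancel x {y ∷ ys} r with y ≟ flip (flip x)
... | no _ = cancelCons-flip x (y ∷ ys)
... | yes y≡x⁻⁻ with refl ← trans y≡x⁻⁻ (flip-involutive x) = cancelCons-≡∷ x r

word-injective : ∀ {u v} → word u ≡ word v → u ≡ v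
word-injective {⟪ _ , _ ⟫} {⟪ _ , _ ⟫} refl = refl

-- The field `reduced` is irrelevant, but letters can be compared, so a usable proof is recomputed
-- from a decision procedure.
word-reduced : ∀ u → Reduced (word u)
word-reduced ⟪ w , r ⟫ = recompute (Linked.linked? (λ x y → ¬? (y ≟ flip x)) w) r

◃-cancel : ∀ x u → x ◃ (flip x ◃ u) ≡ u
◃-cancel x u = word-injective (cancelCons-cancel x (word-reduced u))

flip-◃-cancel : ∀ x u → flip x ◃ (x ◃ u) ≡ u
flip-◃-cancel x u =
  trans (cong (λ y → flip x ◃ (y ◃ u)) (sym (flip-involutive x))) (◃-cancel (flip x) u)

infixr 6 _▹_
-- Letting all words act, not only reduced ones, makes induction on the word possible; `u · v` is
-- `word u ▹ v` by definition.
_▹_ : List Letter → 𝔽₂ → 𝔽₂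
w ▹ u = List.foldr _◃_ u w

cancelCons-▹ : ∀ x w u → cancelCons x w ▹ u ≡ x ◃ (w ▹ u)
cancelCons-▹ x [] u = refl
cancelCons-▹ x (y ∷ w) u with y ≟ flip x
... | yes refl = sym (◃-cancel x (w ▹ u))
... | no _ = refl

▹-· : ∀ w u v → (w ▹ u) · v ≡ w ▹ (u · v)
▹-· [] u v = refl
▹-· (x ∷ w) u v = trans (cancelCons-▹ x (word (w ▹ u)) v) (cong (x ◃_) (▹-· w u v))

·-assoc : ∀ u v w → (u · v) · w ≡ u · (v · w)
·-assoc u v w = ▹-· (word u) v w

word-▹ : ∀ w u → Reduced (w ++ word u) → word (w ▹ u) ≡ w ++ word u
word-▹ [] u r = refl
word-▹ (x ∷ w) u r =
  trans (cong (cancelCons x) (word-▹ w u (Linked.tail r))) (cancelCons-≡∷ x r)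

·-identityʳ : ∀ u → u · 1𝔽 ≡ u
·-identityʳ u = word-injective (trans
  (word-▹ (word u) 1𝔽 (subst Reduced (sym (++-identityʳ (word u))) (word-reduced u)))
  (++-identityʳ (word u)))

-- Inverses in the free group

invWord : List Letter → List Letter
invWord w = reverse (map flip w)

inv : 𝔽₂ → 𝔽₂
inv u = invWord (word u) ▹ 1𝔽

invWord-∷ : ∀ x w → invWord (x ∷ w) ≡ invWord w ++ flip x ∷ []
invWord-∷ x w = unfold-reverse (flip x) (map flip w)

invWord-▹ : ∀ w u → invWord w ▹ w ▹ u ≡ u
invWord-▹ [] u = refl
invWord-▹ (x ∷ w) u = begin
  invWord (x ∷ w) ▹ x ◃ (w ▹ u)          ≡⟨ cong (_▹ (x ◃ (w ▹ u))) (invWord-∷ x w) ⟩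
  (invWord w ++ flip x ∷ []) ▹ x ◃ (w ▹ u) ≡⟨ foldr-++ _◃_ _ (invWord w) (flip x ∷ []) ⟩
  invWord w ▹ flip x ◃ (x ◃ (w ▹ u))     ≡⟨ cong (invWord w ▹_) (flip-◃-cancel x (w ▹ u)) ⟩
  invWord w ▹ w ▹ u                      ≡⟨ invWord-▹ w u ⟩
  u ∎
  where open ≡-Reasoning

▹-invWord : ∀ w u → w ▹ invWord w ▹ u ≡ u
▹-invWord [] u = refl
▹-invWord (x ∷ w) u = begin
  x ◃ (w ▹ invWord (x ∷ w) ▹ u)           ≡⟨ cong (λ y → x ◃ (w ▹ y ▹ u)) (invWord-∷ x w) ⟩
  x ◃ (w ▹ (invWord w ++ flip x ∷ []) ▹ u)
    ≡⟨ cong (λ y → x ◃ (w ▹ y)) (foldr-++ _◃_ u (invWord w) (flip x ∷ [])) ⟩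
  x ◃ (w ▹ invWord w ▹ flip x ◃ u)        ≡⟨ cong (x ◃_) (▹-invWord w (flip x ◃ u)) ⟩
  x ◃ (flip x ◃ u)                        ≡⟨ ◃-cancel x u ⟩
  u ∎
  where open ≡-Reasoning

inv-inverseˡ : ∀ u → inv u · u ≡ 1𝔽
inv-inverseˡ u = begin
  inv u · u                          ≡⟨ ▹-· (invWord (word u)) 1𝔽 u ⟩
  invWord (word u) ▹ u               ≡⟨ cong (invWord (word u) ▹_) (·-identityʳ u) ⟨
  invWord (word u) ▹ word u ▹ 1𝔽     ≡⟨ invWord-▹ (word u) 1𝔽 ⟩
  1𝔽 ∎
  where open ≡-Reasoning

inv-inverseʳ : ∀ u → u · inv u ≡ 1𝔽
inv-inverseʳ u = ▹-invWord (word u) 1𝔽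

𝔽₂-group : Group 0ℓ 0ℓ
𝔽₂-group = record
  { Carrier = 𝔽₂
  ; _≈_ = _≡_
  ; _∙_ = _·_
  ; ε = 1𝔽
  ; _⁻¹ = inv
  ; isGroup = record
    { isMonoid = record
      { isSemigroup = record
        { isMagma = isMagma _·_
        ; assoc = ·-assoc
        }
      ; identity = (λ _ → refl) , ·-identityʳ
      }
    ; inverse = inv-inverseˡ , inv-inverseʳ
    ; ⁻¹-cong = cong inv
    }
  }

replicate-reduced : ∀ n x → Reduced (replicate n x)
replicate-reduced 0 x = []
replicate-reduced 1 x = [-]
replicate-reduced (suc (suc n)) x = x≢flip x ∷ replicate-reduced (suc n) x

^-◃ : ∀ g s n → g ^ (s ℤ.◃ n) ≡ replicate n (g ^± s) ▹ 1𝔽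
^-◃ g s zero = refl
^-◃ g Sign.+ (suc n) = refl
^-◃ g Sign.- (suc n) = refl

-- If c is the part of u that v cancels, then u = p c, v = c⁻¹ q and u v = p q.
record Cancellation (u v uv : List Letter) : Set where
  constructor cancellation
  field
    {p} c {q} : List Letter
    u≡p++c  : u ≡ p ++ c
    v≡c⁻¹++q : v ≡ invWord c ++ q
    uv≡p++q : uv ≡ p ++ q

-- Induction on `w` with first letter `x`. If `p` is empty, `x` meets the head of `q`: either they
-- cancel and `x` joins `c`, or `x` forms the new `p`. If `p` is nonempty, `x` stands before its
-- neighbour in the reduced word `w` and cannot cancel.
▹-cancellation : ∀ {w} → Reduced w → ∀ v → Cancellation w (word v) (word (w ▹ v))
▹-cancellation {[]} r v = cancellation {p = []} [] refl refl refl
▹-cancellation {x ∷ w} r v with ▹-cancellation (Linked.tail r) v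
... | cancellation {[]} c {[]} refl v≡ uv≡ =
  cancellation {p = x ∷ []} c refl v≡ (cong (cancelCons x) uv≡)
... | cancellation {[]} c {y ∷ q} refl v≡ uv≡ rewrite uv≡ with y ≟ flip x
...   | yes refl = cancellation {p = []} (x ∷ c) refl
        (trans v≡ (trans (sym (++-assoc (invWord c) (flip x ∷ []) q))
          (cong (_++ q) (sym (invWord-∷ x c))))) refl
...   | no _ = cancellation {p = x ∷ []} c refl v≡ refl
▹-cancellation {x ∷ w} (y≢ ∷ r) v | cancellation {y ∷ p} c {q} refl v≡ uv≡
  rewrite uv≡ with y ≟ flip x
... | yes y≡ = contradiction y≡ y≢
... | no _ = cancellation {p = x ∷ y ∷ p} c refl v≡ refl

-- Here `p ++ q` is empty, so both words cancel completely. Inverses enter as solutions of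
-- `u · v ≡ 1𝔽`, the form that can be transferred to `M*`.
word-inverse : ∀ u v → u · v ≡ 1𝔽 → word v ≡ invWord (word u)
word-inverse u v uv≡1 with ▹-cancellation (word-reduced u) v
... | cancellation {p} c {q} u≡ v≡ uv≡ with p | q | trans (sym (cong word uv≡1)) uv≡
...   | [] | [] | _ rewrite u≡ = trans v≡ (++-identityʳ _)

-- Sums over runs

run : Letter → List Letter → ℕ
run x [] = 0
run x (y ∷ w) with y ≟ x
... | yes _ = suc (run x w)
... | no _ = 0

run-∷-≡ : ∀ x w → run x (x ∷ w) ≡ suc (run x w)
run-∷-≡ x w with x ≟ x
... | yes _ = refl
... | no x≢x = contradiction refl x≢x

run-∷-≢ : ∀ {x y} w → y ≢ x → run x (y ∷ w) ≡ 0
run-∷-≢ {x} {y} w y≢x with y ≟ x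
... | yes y≡x = contradiction y≡x y≢x
... | no _ = refl

run-all : ∀ {x u} → All (_≡ x) u → ∀ v → run x (u ++ v) ≡ length u ℕ.+ run x v
run-all [] v = refl
run-all {x} {_ ∷ u} (refl ∷ u≡) v =
  trans (run-∷-≡ x (u ++ v)) (cong suc (run-all u≡ v))

run-¬all : ∀ {x u} → ¬ All (_≡ x) u → ∀ v → run x (u ++ v) ≡ run x u
run-¬all {u = []} ¬all v = contradiction [] ¬all
run-¬all {x} {y ∷ u} ¬all v with y ≟ x
... | yes y≡x = cong suc (run-¬all (¬all ∘ (y≡x ∷_)) v)
... | no _ = refl

run-∷ʳ-≢ : ∀ {x y} u → y ≢ x → run x (u ∷ʳ y) ≡ run x u
run-∷ʳ-≢ [] y≢x = run-∷-≢ [] y≢x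
run-∷ʳ-≢ {x} (z ∷ u) y≢x with z ≟ x
... | yes _ = cong suc (run-∷ʳ-≢ u y≢x)
... | no _ = refl

run-map-flip : ∀ x w → run (flip x) (map flip w) ≡ run x w
run-map-flip x [] = refl
run-map-flip x (y ∷ w) with y ≟ x | flip y ≟ flip x
... | yes _ | yes _ = cong suc (run-map-flip x w)
... | yes refl | no ≢ = contradiction refl ≢
... | no ≢ | yes y⁻≡x⁻ = contradiction
  (trans (sym (flip-involutive y)) (trans (cong flip y⁻≡x⁻) (flip-involutive x))) ≢
... | no _ | no _ = refl

◃-opposite : ∀ s n → opposite s ℤ.◃ n ≡ ℤ.- (s ℤ.◃ n)
◃-opposite s zero = refl
◃-opposite Sign.+ (suc n) = refl
◃-opposite Sign.- (suc n) = refl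

i≡-i⇒i≡0 : ∀ {i} → i ≡ ℤ.- i → i ≡ 0ℤ
i≡-i⇒i≡0 {+ zero} _ = refl

∣-∣-triangle : ∀ {m n} i j → ∣ i ∣ ℕ.≤ m → ∣ j ∣ ℕ.≤ n → ∣ i ℤ.+ j ∣ ℕ.≤ m ℕ.+ n
∣-∣-triangle i j i≤m j≤n = ℕ.≤-trans (ℤ.∣i+j∣≤∣i∣+∣j∣ i j) (ℕ.+-mono-≤ i≤m j≤n)

∣-∣-neg : ∀ {m} i → ∣ i ∣ ℕ.≤ m → ∣ ℤ.- i ∣ ℕ.≤ m
∣-∣-neg i = subst (ℕ._≤ _) (sym (ℤ.∣-i∣≡∣i∣ i))

All-reverse : ∀ {p} {P : Letter → Set p} {w} → All P w → All P (reverse w)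
All-reverse {w = w} = All-resp-↭ (↭-sym (↭-reverse w))

module RunSum (φ : Generator → ℤ → ℤ) (φ-odd : ∀ g → Odd (φ g)) where

  γ : Letter → ℕ → ℤ
  γ (g ^± s) n = φ g (s ℤ.◃ n)

  γ-flip : ∀ x n → γ (flip x) n ≡ ℤ.- γ x n
  γ-flip (g ^± s) n = trans (cong (φ g) (◃-opposite s n)) (φ-odd g (s ℤ.◃ n))

  γ-zero : ∀ x → γ x 0 ≡ 0ℤ
  γ-zero (g ^± s) = i≡-i⇒i≡0 (φ-odd g 0ℤ)

  δ : Letter → ℕ → ℤ
  δ x n = γ x (suc n) ℤ.- γ x n

  δ-flip : ∀ x n → δ (flip x) n ≡ ℤ.- δ x n
  δ-flip x n = trans (cong₂ ℤ._-_ (γ-flip x (suc n)) (γ-flip x n))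
    (sym (ℤ.neg-distrib-+ (γ x (suc n)) (ℤ.- γ x n)))

  -- A letter prepended to a run of length n replaces the summand γ x n by γ x (n + 1).
  runSum : List Letter → ℤ
  runSum [] = 0ℤ
  runSum (x ∷ w) = runSum w ℤ.+ δ x (run x w)

  -- The letters of `u` prolong the initial run of `x` in `v`, possibly empty, and their increments
  -- `δ` telescope.
  runSum-all : ∀ {x u} → All (_≡ x) u → ∀ v →
               runSum (u ++ v) ≡ runSum v ℤ.+ (γ x (length u ℕ.+ run x v) ℤ.- γ x (run x v))
  runSum-all {x} [] v = lemma (runSum v) (γ x (run x v))
    where
    lemma : ∀ s t → s ≡ s ℤ.+ (t ℤ.- t)
    lemma = ℤ-Solver.solve-∀
  runSum-all {x} {_ ∷ u} (refl ∷ u≡) v = begin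
    runSum (u ++ v) ℤ.+ δ x (run x (u ++ v))
      ≡⟨ cong₂ (λ s n → s ℤ.+ δ x n) (runSum-all u≡ v) (run-all u≡ v) ⟩
    runSum v ℤ.+ (γ x m ℤ.- γ x n) ℤ.+ (γ x (suc m) ℤ.- γ x m)
      ≡⟨ lemma (runSum v) (γ x m) (γ x n) (γ x (suc m)) ⟩
    runSum v ℤ.+ (γ x (suc m) ℤ.- γ x n) ∎
    where
    open ≡-Reasoning
    n = run x v
    m = length u ℕ.+ n
    lemma : ∀ s p q r → s ℤ.+ (p ℤ.- q) ℤ.+ (r ℤ.- p) ≡ s ℤ.+ (r ℤ.- q)
    lemma = ℤ-Solver.solve-∀

  runSum-power : ∀ {x u} → All (_≡ x) u → runSum u ≡ γ x (length u)
  runSum-power {x} {u} u≡ = begin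
    runSum u                                   ≡⟨ cong runSum (++-identityʳ u) ⟨
    runSum (u ++ [])                           ≡⟨ runSum-all u≡ [] ⟩
    0ℤ ℤ.+ (γ x (length u ℕ.+ 0) ℤ.- γ x 0)
      ≡⟨ cong₂ (λ n z → 0ℤ ℤ.+ (γ x n ℤ.- z)) (ℕ.+-identityʳ (length u)) (γ-zero x) ⟩
    0ℤ ℤ.+ (γ x (length u) ℤ.- 0ℤ)             ≡⟨ lemma (γ x (length u)) ⟩
    γ x (length u) ∎
    where
    open ≡-Reasoning
    lemma : ∀ s → 0ℤ ℤ.+ (s ℤ.- 0ℤ) ≡ s
    lemma = ℤ-Solver.solve-∀

  -- Both sides are meant as the change of `runSum` when `x` is put before `u` and `y` behind it, in
  -- the two possible orders. The letters influence each other only if they are equal and `u` is a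
  -- power of that letter; then the run lengths agree by symmetry.
  δ-exchange : ∀ x y u → δ y (run y (reverse u)) ℤ.+ δ x (run x (u ∷ʳ y)) ≡
                         δ x (run x u) ℤ.+ δ y (run y (reverse u ∷ʳ x))
  δ-exchange x y u with y ≟ x
  ... | no y≢x = trans
    (cong (λ n → δ y (run y (reverse u)) ℤ.+ δ x n) (run-∷ʳ-≢ u y≢x))
    (trans (ℤ.+-comm (δ y _) (δ x _))
      (cong (λ n → δ x (run x u) ℤ.+ δ y n) (sym (run-∷ʳ-≢ (reverse u) (y≢x ∘ sym)))))
  ... | yes refl with All.all? (_≟ x) u
  ...   | no ¬all = trans
    (cong (λ n → δ x (run x (reverse u)) ℤ.+ δ x n) (run-¬all ¬all _))
    (trans (ℤ.+-comm (δ x (run x (reverse u))) (δ x (run x u)))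
      (cong (λ n → δ x (run x u) ℤ.+ δ x n)
        (sym (run-¬all {u = reverse u}
          (¬all ∘ subst (All _) (reverse-involutive u) ∘ All-reverse {w = reverse u}) (x ∷ [])))))
  ...   | yes u≡ = cong₂ (λ m n → δ x m ℤ.+ δ x n)
    (run-reverse _ _ u≡)
    (trans (run-all u≡ (x ∷ []))
      (trans (cong (ℕ._+ run x (x ∷ [])) (sym (length-reverse u)))
        (sym (run-all (All-reverse u≡) (x ∷ [])))))
    where
    run-reverse : ∀ x u → All (_≡ x) u → run x (reverse u) ≡ run x u
    run-reverse x u u≡ = begin
      run x (reverse u)        ≡⟨ cong (run x) (++-identityʳ (reverse u)) ⟨
      run x (reverse u ++ [])  ≡⟨ run-all (All-reverse u≡) [] ⟩
      length (reverse u) ℕ.+ 0 ≡⟨ cong (ℕ._+ 0) (length-reverse u) ⟩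
      length u ℕ.+ 0           ≡⟨ run-all u≡ [] ⟨
      run x (u ++ [])          ≡⟨ cong (run x) (++-identityʳ u) ⟩
      run x u ∎
      where open ≡-Reasoning

  -- `runSum` reads a word from the left; inversion reverses words and so calls for this recursion
  -- from the right.
  runSum-∷ʳ : ∀ u y → runSum (u ∷ʳ y) ≡ runSum u ℤ.+ δ y (run y (reverse u))
  runSum-∷ʳ [] y = refl
  runSum-∷ʳ (x ∷ u) y = begin
    runSum (u ∷ʳ y) ℤ.+ δ x (run x (u ∷ʳ y))
      ≡⟨ cong (ℤ._+ δ x (run x (u ∷ʳ y))) (runSum-∷ʳ u y) ⟩
    runSum u ℤ.+ δ y (run y (reverse u)) ℤ.+ δ x (run x (u ∷ʳ y))
      ≡⟨ ℤ.+-assoc (runSum u) _ _ ⟩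
    runSum u ℤ.+ (δ y (run y (reverse u)) ℤ.+ δ x (run x (u ∷ʳ y)))
      ≡⟨ cong (ℤ._+_ (runSum u)) (δ-exchange x y u) ⟩
    runSum u ℤ.+ (δ x (run x u) ℤ.+ δ y (run y (reverse u ∷ʳ x)))
      ≡⟨ ℤ.+-assoc (runSum u) _ _ ⟨
    runSum u ℤ.+ δ x (run x u) ℤ.+ δ y (run y (reverse u ∷ʳ x))
      ≡⟨ cong (λ w → runSum (x ∷ u) ℤ.+ δ y (run y w)) (unfold-reverse x u) ⟨
    runSum (x ∷ u) ℤ.+ δ y (run y (reverse (x ∷ u))) ∎
    where open ≡-Reasoning

  runSum-invWord : ∀ w → runSum (invWord w) ≡ ℤ.- runSum w
  runSum-invWord [] = refl
  runSum-invWord (x ∷ w) = begin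
    runSum (invWord (x ∷ w))
      ≡⟨ cong runSum (invWord-∷ x w) ⟩
    runSum (invWord w ∷ʳ flip x)
      ≡⟨ runSum-∷ʳ (invWord w) (flip x) ⟩
    runSum (invWord w) ℤ.+ δ (flip x) (run (flip x) (reverse (invWord w)))
      ≡⟨ cong₂ (λ s n → s ℤ.+ δ (flip x) n) (runSum-invWord w)
           (trans (cong (run (flip x)) (reverse-involutive (map flip w))) (run-map-flip x w)) ⟩
    ℤ.- runSum w ℤ.+ δ (flip x) (run x w)
      ≡⟨ cong (ℤ._+_ (ℤ.- runSum w)) (δ-flip x (run x w)) ⟩
    ℤ.- runSum w ℤ.+ ℤ.- δ x (run x w)
      ≡⟨ ℤ.neg-distrib-+ (runSum w) _ ⟨
    ℤ.- (runSum w ℤ.+ δ x (run x w)) ∎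
    where open ≡-Reasoning

  module _ {B : ℕ} (φ-bounded : ∀ g n → ∣ φ g n ∣ ℕ.≤ B) where

    γ-bounded : ∀ x n → ∣ γ x n ∣ ℕ.≤ B
    γ-bounded (g ^± s) n = φ-bounded g (s ℤ.◃ n)

    3B : ℕ
    3B = B ℕ.+ B ℕ.+ B

    -- As long as `u` is not a power of `x`, prepending `x` changes `runSum (u ++ v)` and `runSum u`
    -- equally, so the defect is that of a shorter word. What remains is a single run joined to `v`,
    -- whose defect consists of three values of `γ`; hence the bound does not grow with the length.
    runSum-++ : ∀ u v → ∣ runSum (u ++ v) ℤ.- (runSum u ℤ.+ runSum v) ∣ ℕ.≤ 3B
    runSum-++ [] v = subst (λ s → ∣ s ∣ ℕ.≤ 3B) (sym (lemma (runSum v))) ℕ.z≤n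
      where
      lemma : ∀ s → s ℤ.- (0ℤ ℤ.+ s) ≡ 0ℤ
      lemma = ℤ-Solver.solve-∀
    runSum-++ (x ∷ u) v with All.all? (_≟ x) u
    ... | no ¬all = subst (λ s → ∣ s ∣ ℕ.≤ 3B)
      (trans (lemma (runSum (u ++ v)) (runSum u) (runSum v) (δ x (run x u)))
        (cong (λ n → runSum (u ++ v) ℤ.+ δ x n ℤ.- (runSum u ℤ.+ δ x (run x u) ℤ.+ runSum v))
          (sym (run-¬all ¬all v))))
      (runSum-++ u v)
      where
      lemma : ∀ s t r d → s ℤ.- (t ℤ.+ r) ≡ s ℤ.+ d ℤ.- (t ℤ.+ d ℤ.+ r)
      lemma = ℤ-Solver.solve-∀
    ... | yes u≡ = subst (λ s → ∣ s ∣ ℕ.≤ 3B)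
      (trans (lemma (runSum v) (γ x m) (γ x n) (γ x k))
        (sym (cong₂ (λ s t → s ℤ.- (t ℤ.+ runSum v))
          (runSum-all (refl ∷ u≡) v) (runSum-power (refl ∷ u≡)))))
      (∣-∣-triangle (γ x m ℤ.- γ x n) (ℤ.- γ x k)
        (∣-∣-triangle (γ x m) (ℤ.- γ x n) (γ-bounded x m) (∣-∣-neg (γ x n) (γ-bounded x n)))
        (∣-∣-neg (γ x k) (γ-bounded x k)))
      where
      n = run x v
      k = suc (length u)
      m = k ℕ.+ n
      lemma : ∀ s p q r → p ℤ.- q ℤ.- r ≡ s ℤ.+ (p ℤ.- q) ℤ.- (r ℤ.+ s)
      lemma = ℤ-Solver.solve-∀

    -- The defect is assembled from those of `p ++ c`, `invWord c ++ q` and `p ++ q`; the sums over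
    -- `c` and `invWord c` cancel by oddness.
    runSum-· : ∀ u v → ∣ runSum (word u) ℤ.+ runSum (word v) ℤ.- runSum (word (u · v)) ∣
                       ℕ.≤ 3B ℕ.+ 3B ℕ.+ 3B
    runSum-· u v with ▹-cancellation (word-reduced u) v
    ... | cancellation {p} c {q} u≡ v≡ uv≡ rewrite u≡ | v≡ | uv≡ = subst (λ s → ∣ s ∣ ℕ.≤ _)
      (trans (cong (λ t → e₁ ℤ.+ (F (invWord c ++ q) ℤ.- (t ℤ.+ F q)) ℤ.+ ℤ.- e₃) (runSum-invWord c))
             (lemma (F (p ++ c)) (F (invWord c ++ q)) (F (p ++ q)) (F p) (F c) (F q)))
      (∣-∣-triangle (e₁ ℤ.+ e₂) (ℤ.- e₃)
        (∣-∣-triangle e₁ e₂ (runSum-++ p c) (runSum-++ (invWord c) q))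
        (∣-∣-neg e₃ (runSum-++ p q)))
      where
      F = runSum
      e₁ = F (p ++ c) ℤ.- (F p ℤ.+ F c)
      e₂ = F (invWord c ++ q) ℤ.- (F (invWord c) ℤ.+ F q)
      e₃ = F (p ++ q) ℤ.- (F p ℤ.+ F q)
      lemma : ∀ r s t p c q → r ℤ.- (p ℤ.+ c) ℤ.+ (s ℤ.- (ℤ.- c ℤ.+ q)) ℤ.+ ℤ.- (t ℤ.- (p ℤ.+ q))
              ≡ r ℤ.+ s ℤ.- t
      lemma = ℤ-Solver.solve-∀

-- Syllables and the values of f

other : Generator → Generator
other a = b
other b = a

≢⇒≡other : ∀ {g h} → h ≢ g → h ≡ other g
≢⇒≡other {a} {a} h≢g = contradiction refl h≢g
≢⇒≡other {a} {b} _ = refl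
≢⇒≡other {b} {a} _ = refl
≢⇒≡other {b} {b} h≢g = contradiction refl h≢g

other≢ : ∀ g → other g ≢ g
other≢ a ()
other≢ b ()

-- The syllable g^(±(n + 1)) is syllable ± n.
data Syllables (g : Generator) : Set where
  []       : Syllables g
  syllable : Sign → ℕ → Syllables (other g) → Syllables g

spell : ∀ {g} → Syllables g → List Letter
spell [] = []
spell {g} (syllable s n σ) = replicate (suc n) (g ^± s) ++ spell σ

signs≢⇒flip : ∀ {g s t} → g ^± s ≢ g ^± t → g ^± s ≡ flip (g ^± t)
signs≢⇒flip {s = Sign.+} {Sign.+} ≢ = contradiction refl ≢
signs≢⇒flip {s = Sign.+} {Sign.-} ≢ = refl
signs≢⇒flip {s = Sign.-} {Sign.+} ≢ = refl
signs≢⇒flip {s = Sign.-} {Sign.-} ≢ = contradiction refl ≢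

syllables : ∀ {w} → Reduced w → ∃[ g ] Σ[ σ ∈ Syllables g ] spell σ ≡ w
syllables {[]} _ = a , [] , refl
syllables {(g ^± s) ∷ w} r with syllables (Linked.tail r)
... | _ , [] , refl = g , syllable s 0 [] , refl
... | h , syllable t n σ , refl with h ≟ᴳ g
...   | no h≢g with refl ← ≢⇒≡other h≢g = g , syllable s 0 (syllable t n σ) , refl
...   | yes refl with (g ^± t) ≟ (g ^± s)
...     | yes refl = g , syllable s (suc n) σ , refl
...     | no t≢s = contradiction (signs≢⇒flip t≢s) (Linked.head r)

reduced-++ʳ : ∀ u {v} → Reduced (u ++ v) → Reduced v
reduced-++ʳ [] r = r
reduced-++ʳ (x ∷ u) r = reduced-++ʳ u (Linked.tail r)

evaluate : ∀ {g} → Syllables g → 𝔽₂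
evaluate [] = 1𝔽
evaluate {g} (syllable s n σ) = g ^ (s ℤ.◃ suc n) · evaluate σ

word-evaluate : ∀ {g} (σ : Syllables g) → Reduced (spell σ) → word (evaluate σ) ≡ spell σ
word-evaluate [] _ = refl
word-evaluate {g} (syllable s n σ) r = begin
  word (g ^ (s ℤ.◃ suc n) · evaluate σ)
    ≡⟨ cong (λ u → word (u · evaluate σ)) (^-◃ g s (suc n)) ⟩
  word ((replicate (suc n) (g ^± s) ▹ 1𝔽) · evaluate σ)
    ≡⟨ cong word (▹-· (replicate (suc n) (g ^± s)) 1𝔽 (evaluate σ)) ⟩
  word (replicate (suc n) (g ^± s) ▹ evaluate σ)
    ≡⟨ word-▹ (replicate (suc n) (g ^± s)) (evaluate σ)
           (subst (λ w → Reduced (replicate (suc n) (g ^± s) ++ w)) (sym ih) r) ⟩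
  replicate (suc n) (g ^± s) ++ word (evaluate σ)      ≡⟨ cong (replicate (suc n) (g ^± s) ++_) ih ⟩
  replicate (suc n) (g ^± s) ++ spell σ                ∎
  where
  open ≡-Reasoning
  ih = word-evaluate σ (reduced-++ʳ (replicate (suc n) (g ^± s)) r)

run-spell-other : ∀ g s (σ : Syllables (other g)) → run (g ^± s) (spell σ) ≡ 0
run-spell-other g s [] = refl
run-spell-other g s (syllable t n σ) =
  run-∷-≢ (replicate n (other g ^± t) ++ spell σ) (other≢ g ∘ cong Letter.generator)

◃-suc≢0 : ∀ s n → s ℤ.◃ suc n ≢ 0ℤ
◃-suc≢0 Sign.+ n ()
◃-suc≢0 Sign.- n ()

-- Powers of a generator

replicate-▹-◃ : ∀ n x u → replicate n x ▹ x ◃ u ≡ x ◃ (replicate n x ▹ u)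
replicate-▹-◃ zero x u = refl
replicate-▹-◃ (suc n) x u = cong (x ◃_) (replicate-▹-◃ n x u)

replicate-cancel : ∀ n x u → replicate n (flip x) ▹ replicate n x ▹ u ≡ u
replicate-cancel zero x u = refl
replicate-cancel (suc n) x u = begin
  flip x ◃ (replicate n (flip x) ▹ x ◃ (replicate n x ▹ u))
    ≡⟨ cong (λ v → flip x ◃ (replicate n (flip x) ▹ v)) (replicate-▹-◃ n x u) ⟨
  flip x ◃ (replicate n (flip x) ▹ replicate n x ▹ x ◃ u)
    ≡⟨ cong (flip x ◃_) (replicate-cancel n x (x ◃ u)) ⟩
  flip x ◃ (x ◃ u)
    ≡⟨ flip-◃-cancel x u ⟩
  u ∎
  where open ≡-Reasoning

open Mult (Group.monoid 𝔽₂-group) using (×-homo-+; ×-assocˡ; ×-congˡ) renaming (_×_ to infixr 8 _⨰_)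

^-⨰ : ∀ g n → g ^ (+ n) ≡ n ⨰ (g ^ (+ 1))
^-⨰ g zero = refl
^-⨰ g (suc n) = cong ((g ^± Sign.+) ◃_) (^-⨰ g n)

^-homo-+ : ∀ g m n → g ^ (+ (m ℕ.+ n)) ≡ g ^ (+ m) · g ^ (+ n)
^-homo-+ g m n = trans (^-⨰ g (m ℕ.+ n))
  (trans (×-homo-+ (g ^ (+ 1)) m n) (sym (cong₂ _·_ (^-⨰ g m) (^-⨰ g n))))

⨰-^ : ∀ n g m → n ⨰ (g ^ (+ m)) ≡ g ^ (+ (n ℕ.* m))
⨰-^ n g m = trans (cong (n ⨰_) (^-⨰ g m))
  (trans (×-assocˡ (g ^ (+ 1)) n m) (sym (^-⨰ g (n ℕ.* m))))

inv-^ : ∀ g n → inv (g ^ (+ n)) ≡ g ^ (ℤ.- + n)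
inv-^ g n = sym (GroupProperties.inverseˡ-unique 𝔽₂-group (g ^ (ℤ.- + n)) (g ^ (+ n)) (begin
  g ^ (ℤ.- + n) · g ^ (+ n)
    ≡⟨ cong (λ k → g ^ k · g ^ (+ n))
         (trans (cong ℤ.-_ (sym (ℤ.+◃n≡+n n))) (sym (◃-opposite Sign.+ n))) ⟩
  g ^ (Sign.- ℤ.◃ n) · g ^ (+ n)
    ≡⟨ cong (_· g ^ (+ n)) (^-◃ g Sign.- n) ⟩
  (replicate n (g ^± Sign.-) ▹ 1𝔽) · g ^ (+ n)
    ≡⟨ ▹-· (replicate n (g ^± Sign.-)) 1𝔽 (g ^ (+ n)) ⟩
  replicate n (g ^± Sign.-) ▹ g ^ (+ n)
    ≡⟨ replicate-cancel n (g ^± Sign.+) 1𝔽 ⟩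
  1𝔽 ∎))
  where open ≡-Reasoning

-- The values of `f` as sums over runs

module Values (α β : ℤ → ℤ) (α-odd : Odd α) (β-odd : Odd β)
              (f : 𝔽₂ → ℤ) (f-given : GivenBy α β f) where

  φ : Generator → ℤ → ℤ
  φ a = α
  φ b = β

  φ-odd : ∀ g → Odd (φ g)
  φ-odd a = α-odd
  φ-odd b = β-odd

  open RunSum φ φ-odd

  φ-zero : ∀ g → φ g 0ℤ ≡ 0ℤ
  φ-zero g = γ-zero (g ^± Sign.+)

  total : ∀ {g} → Syllables g → ℤ
  total [] = 0ℤ
  total {g} (syllable s n σ) = φ g (s ℤ.◃ suc n) ℤ.+ total σ

  runSum-spell : ∀ {g} (σ : Syllables g) → runSum (spell σ) ≡ total σ
  runSum-spell [] = refl
  runSum-spell {g} (syllable s n σ) = begin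
    runSum (u ++ spell σ)
      ≡⟨ runSum-all (All.replicate⁺ (suc n) refl) (spell σ) ⟩
    runSum (spell σ) ℤ.+ (γ x (length u ℕ.+ run x (spell σ)) ℤ.- γ x (run x (spell σ)))
      ≡⟨ cong₂ (λ m k → runSum (spell σ) ℤ.+ (γ x (m ℕ.+ k) ℤ.- γ x k))
           (length-replicate (suc n)) (run-spell-other g s σ) ⟩
    runSum (spell σ) ℤ.+ (γ x (suc n ℕ.+ 0) ℤ.- γ x 0)
      ≡⟨ cong₂ (λ m z → runSum (spell σ) ℤ.+ (γ x m ℤ.- z)) (ℕ.+-identityʳ (suc n)) (γ-zero x) ⟩
    runSum (spell σ) ℤ.+ (γ x (suc n) ℤ.- 0ℤ)
      ≡⟨ cong₂ ℤ._+_ (runSum-spell σ) (ℤ.+-identityʳ (γ x (suc n))) ⟩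
    total σ ℤ.+ γ x (suc n)
      ≡⟨ ℤ.+-comm (total σ) _ ⟩
    γ x (suc n) ℤ.+ total σ ∎
    where
    open ≡-Reasoning
    x = g ^± s
    u = replicate (suc n) x

  -- u = a^n₀ b^m₀ ⋯ a^nⱼ b^mⱼ with exponents as in GivenBy and with P n₀.
  record Expression (P : ℤ → Set) (u : 𝔽₂) (z : ℤ) : Set where
    field
      j : ℕ
      n m : Vector ℤ (suc j)
      n≢0 : ∀ i → i ≢ Fin.zero → n i ≢ 0ℤ
      m≢0 : ∀ i → i ≢ fromℕ j → m i ≢ 0ℤ
      P-n₀ : P (n Fin.zero)
      value : Vector.foldr _·_ 1𝔽 (λ i → a ^ n i · b ^ m i) ≡ u
      sum : Vector.foldr ℤ._+_ 0ℤ (λ i → α (n i) ℤ.+ β (m i)) ≡ z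

  f-expression : ∀ {P u z} → Expression P u z → f u ≡ z
  f-expression e = trans (cong f (sym value)) (trans (f-given j n m n≢0 m≢0) sum)
    where open Expression e

  -- A product that starts with `b` gets the first `a`-exponent 0, which contributes `α 0ℤ`, zero by
  -- oddness.
  expression-b : ∀ m → Expression (_≡ 0ℤ) (b ^ m · 1𝔽) (β m ℤ.+ 0ℤ)
  expression-b m = record
    { j = 0
    ; n = λ _ → 0ℤ
    ; m = λ _ → m
    ; n≢0 = λ { Fin.zero 0≢0 → contradiction refl 0≢0 }
    ; m≢0 = λ { Fin.zero 0≢0 → contradiction refl 0≢0 }
    ; P-n₀ = refl
    ; value = refl
    ; sum = cong (ℤ._+ 0ℤ) (trans (cong (ℤ._+ β m) (φ-zero a)) (ℤ.+-identityˡ (β m)))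
    }

  expression-1 : Expression (_≡ 0ℤ) 1𝔽 0ℤ
  expression-1 = subst (Expression (_≡ 0ℤ) 1𝔽)
    (trans (ℤ.+-identityʳ (β 0ℤ)) (φ-zero b)) (expression-b 0ℤ)

  -- The expression of `u` begins with the idle power `a ^ 0ℤ`; the new syllable takes its place.
  prepend-a : ∀ n₀ {u z} → n₀ ≢ 0ℤ → Expression (_≡ 0ℤ) u z →
              Expression (_≢ 0ℤ) (a ^ n₀ · u) (α n₀ ℤ.+ z)
  prepend-a n₀ {u} {z} n₀≢0 e = record
    { j = j
    ; n = n₀ Vector.∷ Vector.tail n
    ; m = m
    ; n≢0 = λ { Fin.zero 0≢0 → contradiction refl 0≢0 ; (Fin.suc i) → n≢0 (Fin.suc i) }
    ; m≢0 = m≢0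
    ; P-n₀ = n₀≢0
    ; value = trans (·-assoc (a ^ n₀) (b ^ m Fin.zero) _)
        (cong (a ^ n₀ ·_) (trans (cong (λ k → a ^ k · b ^ m Fin.zero · rest) (sym P-n₀)) value))
    ; sum = trans (ℤ.+-assoc (α n₀) (β (m Fin.zero)) _)
        (cong (ℤ._+_ (α n₀)) (trans (cong (ℤ._+ restSum) (sym α+β)) sum))
    }
    where
    open Expression e
    rest = Vector.foldr _·_ 1𝔽 (Vector.tail (λ i → a ^ n i · b ^ m i))
    restSum = Vector.foldr ℤ._+_ 0ℤ (Vector.tail (λ i → α (n i) ℤ.+ β (m i)))
    α+β : α (n Fin.zero) ℤ.+ β (m Fin.zero) ≡ β (m Fin.zero)
    α+β = trans (cong (ℤ._+ β (m Fin.zero)) (trans (cong α P-n₀) (φ-zero a)))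
      (ℤ.+-identityˡ (β (m Fin.zero)))

  -- A new pair `a ^ 0ℤ · b ^ m₀` goes in front. The former first exponent of `a` becomes an inner
  -- one and so must be known to be nonzero; this is what `P` records.
  prepend-b : ∀ m₀ {u z} → m₀ ≢ 0ℤ → Expression (_≢ 0ℤ) u z →
              Expression (_≡ 0ℤ) (b ^ m₀ · u) (β m₀ ℤ.+ z)
  prepend-b m₀ {u} {z} m₀≢0 e = record
    { j = suc j
    ; n = 0ℤ Vector.∷ n
    ; m = m₀ Vector.∷ m
    ; n≢0 = λ { Fin.zero 0≢0 → contradiction refl 0≢0
              ; (Fin.suc Fin.zero) _ → P-n₀
              ; (Fin.suc (Fin.suc i)) _ → n≢0 (Fin.suc i) λ () }
    ; m≢0 = λ { Fin.zero _ → m₀≢0 ; (Fin.suc i) i≢ → m≢0 i (i≢ ∘ cong Fin.suc) }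
    ; P-n₀ = refl
    ; value = cong (b ^ m₀ ·_) value
    ; sum = cong₂ ℤ._+_
        (trans (cong (ℤ._+ β m₀) (φ-zero a)) (ℤ.+-identityˡ (β m₀))) sum
    }
    where open Expression e

  mutual
    expression-bσ : (σ : Syllables b) → Expression (_≡ 0ℤ) (evaluate σ) (total σ)
    expression-bσ [] = expression-1
    -- A final power of `b` stands alone: put before the expression of `1𝔽`, it would create an
    -- inner exponent 0.
    expression-bσ (syllable s n []) = expression-b (s ℤ.◃ suc n)
    expression-bσ (syllable s n (syllable t k σ)) =
      prepend-b (s ℤ.◃ suc n) (◃-suc≢0 s n) (expression-aσ t k σ)

    expression-aσ : ∀ s n (σ : Syllables b) →
      Expression (_≢ 0ℤ) (evaluate (syllable {a} s n σ)) (total (syllable {a} s n σ))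
    expression-aσ s n σ = prepend-a (s ℤ.◃ suc n) (◃-suc≢0 s n) (expression-bσ σ)

  f-evaluate : ∀ {g} (σ : Syllables g) → f (evaluate σ) ≡ total σ
  f-evaluate [] = f-expression expression-1
  f-evaluate {a} (syllable s n σ) = f-expression (expression-aσ s n σ)
  f-evaluate {b} (syllable s n σ) = f-expression (expression-bσ (syllable s n σ))

  f≡runSum : ∀ u → f u ≡ runSum (word u)
  f≡runSum u with syllables (word-reduced u)
  ... | g , σ , spell-σ = begin
    f u
      ≡⟨ cong f (word-injective {evaluate σ} {u} (trans (word-evaluate σ σ-reduced) spell-σ)) ⟨
    f (evaluate σ)    ≡⟨ f-evaluate σ ⟩
    total σ           ≡⟨ runSum-spell σ ⟨
    runSum (spell σ)  ≡⟨ cong runSum spell-σ ⟩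
    runSum (word u)   ∎
    where
    open ≡-Reasoning
    σ-reduced = subst Reduced (sym spell-σ) (word-reduced u)

  f-inverse : ∀ u v → u · v ≡ 1𝔽 → f v ≡ ℤ.- f u
  f-inverse u v uv≡1 = begin
    f v                        ≡⟨ f≡runSum v ⟩
    runSum (word v)            ≡⟨ cong runSum (word-inverse u v uv≡1) ⟩
    runSum (invWord (word u))  ≡⟨ runSum-invWord (word u) ⟩
    ℤ.- runSum (word u)        ≡⟨ cong ℤ.-_ (f≡runSum u) ⟨
    ℤ.- f u                    ∎
    where open ≡-Reasoning

  f-1 : f 1𝔽 ≡ 0ℤ
  f-1 = f≡runSum 1𝔽

  f-power : ∀ g n → f (g ^ (+ n)) ≡ φ g (+ n)
  f-power g n = begin
    f (g ^ (+ n))                    ≡⟨ f≡runSum (g ^ (+ n)) ⟩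
    runSum (word (g ^ (+ n)))
      ≡⟨ cong runSum (word-▹ u 1𝔽
           (subst Reduced (sym (++-identityʳ u)) (replicate-reduced n x))) ⟩
    runSum (u ++ [])                 ≡⟨ cong runSum (++-identityʳ u) ⟩
    runSum u                         ≡⟨ runSum-power (All.replicate⁺ n refl) ⟩
    φ g (Sign.+ ℤ.◃ length u)
      ≡⟨ cong (φ g) (trans (ℤ.+◃n≡+n (length u)) (cong +_ (length-replicate n))) ⟩
    φ g (+ n)                        ∎
    where
    open ≡-Reasoning
    x = g ^± Sign.+
    u = replicate n x

  f-alternating : ∀ {n m} → n ≢ 0ℤ → m ≢ 0ℤ → ∀ k →
                  f (k ⨰ (a ^ n · b ^ m)) ≡ + k ℤ.* (α n ℤ.+ β m)
  f-alternating n≢0 m≢0 zero = f-1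
  f-alternating {n} {m} n≢0 m≢0 (suc k) = begin
    f (suc k ⨰ (a ^ n · b ^ m))
      ≡⟨ cong f (foldr-const (suc k)) ⟨
    f (Vector.foldr _·_ 1𝔽 {suc k} (λ _ → a ^ n · b ^ m))
      ≡⟨ f-given k (λ _ → n) (λ _ → m) (λ _ _ → n≢0) (λ _ _ → m≢0) ⟩
    Vector.foldr ℤ._+_ 0ℤ {suc k} (λ _ → α n ℤ.+ β m)
      ≡⟨ sum-const (α n ℤ.+ β m) (suc k) ⟩
    + suc k ℤ.* (α n ℤ.+ β m) ∎
    where
    open ≡-Reasoning
    foldr-const : ∀ j → Vector.foldr _·_ 1𝔽 {j} (λ _ → a ^ n · b ^ m) ≡ j ⨰ (a ^ n · b ^ m)
    foldr-const zero = refl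
    foldr-const (suc j) = cong (a ^ n · b ^ m ·_) (foldr-const j)
    sum-const : ∀ z j → Vector.foldr ℤ._+_ 0ℤ {j} (λ _ → z) ≡ + j ℤ.* z
    sum-const z zero = refl
    sum-const z (suc j) = trans (cong (ℤ._+_ z) (sum-const z j)) (sym (ℤ.suc-* (+ j) z))

-- Quasimorphisms at bounded distance from a homomorphism

n<2^n : ∀ n → n ℕ.< 2 ℕ.^ n
n<2^n zero = ℕ.s≤s ℕ.z≤n
n<2^n (suc n) = ℕ.≤-trans (ℕ.+-mono-≤ (ℕ.m^n>0 2 n) (n<2^n n))
  (ℕ.≤-reflexive (cong (2 ℕ.^ n ℕ.+_) (sym (ℕ.+-identityʳ (2 ℕ.^ n)))))

small-multiple : ∀ n z → ∣ + n ℤ.* z ∣ ℕ.< n → z ≡ 0ℤ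
small-multiple n z nz<n = ℤ.∣i∣≡0⇒i≡0 (ℕ.n<1⇒n≡0 (ℕ.*-cancelˡ-< n ∣ z ∣ 1
  (subst₂ ℕ._<_ (ℤ.∣i*j∣≡∣i∣*∣j∣ (+ n) z) (sym (ℕ.*-identityʳ n)) nz<n)))

-- `S i` stands for the standard points of the `i`-th set in a chain that shrinks towards a
-- subgroup; taking a quotient costs one index.
module NoApproximateHomomorphism
  (α β : ℤ → ℤ) (α-odd : Odd α) (β-odd : Odd β)
  (B : ℕ) (α-bounded : ∀ n → ∣ α n ∣ ℕ.≤ B)
  (f : 𝔽₂ → ℤ) (f-given : GivenBy α β f)
  (s : Level) (S : ℕ → 𝔽₂ → ℤ → Set s)
  (S-1 : ∀ i → S i 1𝔽 0ℤ)
  (S-quotient : ∀ {i u v x y} → S (suc i) u x → S (suc i) v y → S i (inv u · v) (y ℤ.- x))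
  (N : ℕ) (S-near : ∀ {u x} → S 0 u x → ∣ x ℤ.- f u ∣ ℕ.≤ N)
  where

  open Values α β α-odd β-odd f f-given
  open GroupProperties 𝔽₂-group using (⁻¹-involutive)

  S-inverse : ∀ {i u x} → S (suc i) u x → S i (inv u) (ℤ.- x)
  S-inverse {u = u} {x} h =
    subst₂ (S _) (·-identityʳ (inv u)) (ℤ.+-identityˡ (ℤ.- x)) (S-quotient h (S-1 _))

  S-descend : ∀ {i u x} → S (suc i) u x → S i u x
  S-descend {u = u} {x} h = subst (S _ u) (ℤ.+-identityʳ x) (S-quotient (S-1 _) h)

  S-product : ∀ {i u v x y} → S (2 ℕ.+ i) u x → S (2 ℕ.+ i) v y → S i (u · v) (x ℤ.+ y)
  S-product {u = u} {v} {x} {y} h k =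
    subst₂ (S _) (cong (_· v) (⁻¹-involutive u)) (lemma x y) (S-quotient (S-inverse h) (S-descend k))
    where
    lemma : ∀ x y → y ℤ.- ℤ.- x ≡ x ℤ.+ y
    lemma = ℤ-Solver.solve-∀

  -- Repeated squaring. A product is a quotient by an inverse and costs two indices, so `i`
  -- squarings cost `i ℕ.* 2`.
  S-power : ∀ i {u x} → S (i ℕ.* 2) u x → S 0 ((2 ℕ.^ i) ⨰ u) (+ (2 ℕ.^ i) ℤ.* x)
  S-power zero {u} {x} h =
    subst₂ (S 0) (sym (·-identityʳ u)) (sym (ℤ.*-identityˡ x)) h
  S-power (suc i) {u} {x} h = subst₂ (S 0) eqᵤ eqₓ (S-power i (S-product h h))
    where
    n = 2 ℕ.^ i
    eqᵤ : n ⨰ (u · u) ≡ (2 ℕ.* n) ⨰ u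
    eqᵤ = trans (cong (λ v → n ⨰ (u · v)) (sym (·-identityʳ u)))
      (trans (×-assocˡ u n 2) (×-congˡ (ℕ.*-comm n 2)))
    lemma : ∀ n x → n ℤ.* (x ℤ.+ x) ≡ (n ℤ.+ (n ℤ.+ 0ℤ)) ℤ.* x
    lemma = ℤ-Solver.solve-∀
    eqₓ : + n ℤ.* (x ℤ.+ x) ≡ + (2 ℕ.* n) ℤ.* x
    eqₓ = lemma (+ n) x

  -- Ensures that `2 ℕ.^ depth` exceeds `N ℕ.+ B`, where `N` is the distance from `f` and `B` bounds
  -- `f` on the powers of `a`.
  depth : ℕ
  depth = N ℕ.+ B

  n = 2 ℕ.^ depth

  -- On the `n`-th power `f` is exactly `n` times the claimed value, while `n ℤ.* x` is within `N`
  -- of `f`. As `n` exceeds `N`, the difference before multiplication must vanish.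
  S-alternating : ∀ {p q x} → p ≢ 0ℤ → q ≢ 0ℤ → S (depth ℕ.* 2) (a ^ p · b ^ q) x →
                  x ≡ α p ℤ.+ β q
  S-alternating {p} {q} {x} p≢0 q≢0 h = ℤ.i-j≡0⇒i≡j x (α p ℤ.+ β q)
    (small-multiple n (x ℤ.- (α p ℤ.+ β q)) (begin-strict
      ∣ + n ℤ.* (x ℤ.- (α p ℤ.+ β q)) ∣
        ≡⟨ cong ∣_∣ (lemma (+ n) x (α p ℤ.+ β q)) ⟩
      ∣ + n ℤ.* x ℤ.- + n ℤ.* (α p ℤ.+ β q) ∣
        ≡⟨ cong (λ y → ∣ + n ℤ.* x ℤ.- y ∣) (f-alternating p≢0 q≢0 n) ⟨
      ∣ + n ℤ.* x ℤ.- f (n ⨰ (a ^ p · b ^ q)) ∣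
        ≤⟨ S-near (S-power depth h) ⟩
      N
        ≤⟨ ℕ.m≤m+n N B ⟩
      depth
        <⟨ n<2^n depth ⟩
      n ∎))
    where
    open ℕ.≤-Reasoning
    lemma : ∀ n x y → n ℤ.* (x ℤ.- y) ≡ n ℤ.* x ℤ.- n ℤ.* y
    lemma = ℤ-Solver.solve-∀

  -- A power of `a` is a single run, so `f` stays bounded by `B` on all of them and `n ℤ.* x` cannot
  -- reach `n` in absolute value.
  S-power-a : ∀ {p x} → S (depth ℕ.* 2) (a ^ (+ p)) x → x ≡ 0ℤ
  S-power-a {p} {x} h = small-multiple n x (begin-strict
    ∣ + n ℤ.* x ∣
      ≡⟨ cong ∣_∣ (lemma (+ n ℤ.* x) fᵃ) ⟩
    ∣ (+ n ℤ.* x ℤ.- fᵃ) ℤ.+ fᵃ ∣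
      ≤⟨ ∣-∣-triangle (+ n ℤ.* x ℤ.- fᵃ) fᵃ (S-near (S-power depth h)) fᵃ≤B ⟩
    depth
      <⟨ n<2^n depth ⟩
    n ∎)
    where
    open ℕ.≤-Reasoning
    fᵃ = f (n ⨰ (a ^ (+ p)))
    fᵃ≤B : ∣ fᵃ ∣ ℕ.≤ B
    fᵃ≤B = subst (λ z → ∣ z ∣ ℕ.≤ B)
      (sym (trans (cong f (⨰-^ n a p)) (f-power a (n ℕ.* p)))) (α-bounded (+ (n ℕ.* p)))
    lemma : ∀ x y → x ≡ (x ℤ.- y) ℤ.+ y
    lemma = ℤ-Solver.solve-∀

  -- Adding the values that `S-alternating` gives for `x + y` and `x - y` shows that `x + x` is
  -- twice `α (+ p)`, and `x` is zero by `S-power-a`. The two extra indices pay for the product and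
  -- for the quotient.
  α-vanishes : ∀ {p q x y} → + p ≢ 0ℤ → + q ≢ 0ℤ →
    S (2 ℕ.+ depth ℕ.* 2) (a ^ (+ p)) x → S (2 ℕ.+ depth ℕ.* 2) (b ^ (+ q)) y → α (+ p) ≡ 0ℤ
  α-vanishes {p} {q} {x} {y} p≢0 q≢0 h k = i≡-i⇒i≡0 (begin
    α (+ p)                                            ≡⟨ lemma (α (+ p)) (β (+ q)) ⟩
    (α (+ p) ℤ.+ β (+ q)) ℤ.+ (α (+ p) ℤ.- β (+ q)) ℤ.- α (+ p)
      ≡⟨ cong₂ (λ s t → s ℤ.+ t ℤ.- α (+ p)) (sym ab)
           (sym (trans ab⁻¹ (cong (ℤ._+_ (α (+ p))) (β-odd (+ q))))) ⟩
    (x ℤ.+ y) ℤ.+ (x ℤ.- y) ℤ.- α (+ p)                ≡⟨ lemma′ x y (α (+ p)) ⟩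
    (x ℤ.+ x) ℤ.- α (+ p)                              ≡⟨ cong (λ s → (s ℤ.+ s) ℤ.- α (+ p)) x≡0 ⟩
    0ℤ ℤ.- α (+ p)                                     ≡⟨ ℤ.+-identityˡ (ℤ.- α (+ p)) ⟩
    ℤ.- α (+ p)                                        ∎)
    where
    open ≡-Reasoning
    x≡0 = S-power-a {p} (S-descend (S-descend h))
    ab = S-alternating p≢0 q≢0 (S-product h k)
    ab⁻¹ : x ℤ.- y ≡ α (+ p) ℤ.+ β (ℤ.- + q)
    -- The quotient of the two inverse pairs has first coordinate `a ^ (+ p)` times the inverse of
    -- `b ^ (+ q)`.
    ab⁻¹ = S-alternating p≢0 (q≢0 ∘ ℤ.neg-injective)
      (subst₂ (S _) (cong₂ _·_ (⁻¹-involutive (a ^ (+ p))) (inv-^ b q)) (lemma″ x y)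
        (S-quotient (S-inverse h) (S-inverse k)))
      where
      lemma″ : ∀ x y → ℤ.- y ℤ.- ℤ.- x ≡ x ℤ.- y
      lemma″ = ℤ-Solver.solve-∀
    lemma : ∀ s t → s ≡ (s ℤ.+ t) ℤ.+ (s ℤ.- t) ℤ.- s
    lemma = ℤ-Solver.solve-∀
    lemma′ : ∀ x y s → (x ℤ.+ y) ℤ.+ (x ℤ.- y) ℤ.- s ≡ (x ℤ.+ x) ℤ.- s
    lemma′ = ℤ-Solver.solve-∀

-- Renaming of variables and compactness

module _ {S : Set} {ℓ : Level} {L : Language S ℓ} where

  Renaming : List S → List S → Set
  Renaming Γ Δ = ∀ {s} → s ∈ Γ → s ∈ Δ

  weaken : ∀ {Γ Δ} → Renaming Γ Δ → ∀ s → Renaming (s ∷ Γ) (s ∷ Δ)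
  weaken r s (here s≡) = here s≡
  weaken r s (there x) = there (r x)

  mutual
    renameTerm : ∀ {Γ Δ s} → Renaming Γ Δ → Term L Γ s → Term L Δ s
    renameTerm r (var x) = var (r x)
    renameTerm r (app F ts) = app F (renameTerms r ts)

    renameTerms : ∀ {Γ Δ ss} → Renaming Γ Δ → All (Term L Γ) ss → All (Term L Δ) ss
    renameTerms r [] = []
    renameTerms r (t ∷ ts) = renameTerm r t ∷ renameTerms r ts

  rename : ∀ {Γ Δ} → Renaming Γ Δ → Formula L Γ → Formula L Δ
  rename r (eq t u) = eq (renameTerm r t) (renameTerm r u)
  rename r (atom R ts) = atom R (renameTerms r ts)
  rename r bot = bot
  rename r (and φ ψ) = and (rename r φ) (rename r ψ)
  rename r (or φ ψ) = or (rename r φ) (rename r ψ)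
  rename r (impl φ ψ) = impl (rename r φ) (rename r ψ)
  rename r (all s φ) = all s (rename (weaken r s) φ)
  rename r (ex s φ) = ex s (rename (weaken r s) φ)

  neg : ∀ {Γ} → Formula L Γ → Formula L Γ
  neg φ = impl φ bot

  conjunction : ∀ {Γ} → List (Formula L Γ) → Formula L Γ
  conjunction = List.foldr and (neg bot)

  module _ {c : Level} (M : Structure L c) where
    open Structure M
    open Equivalence

    infix 4 _↾_≗_
    record _↾_≗_ {Γ Δ} (ρ′ : All Carrier Δ) (r : Renaming Γ Δ) (ρ : All Carrier Γ) : Set c where
      constructor pointwise
      field
        lookup≡ : ∀ {s} (x : s ∈ Γ) → All.lookup ρ′ (r x) ≡ All.lookup ρ x
    open _↾_≗_

    weaken-≗ : ∀ {Γ Δ} {r : Renaming Γ Δ} {ρ ρ′} → ρ′ ↾ r ≗ ρ →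
               ∀ {s} (m : Carrier s) → (m ∷ ρ′) ↾ weaken r s ≗ (m ∷ ρ)
    weaken-≗ e m = pointwise λ { (here refl) → refl ; (there x) → lookup≡ e x }

    mutual
      ⟦renameTerm⟧ : ∀ {Γ Δ s} {r : Renaming Γ Δ} {ρ ρ′} → ρ′ ↾ r ≗ ρ →
                     (t : Term L Γ s) → ⟦_⟧ M (renameTerm r t) ρ′ ≡ ⟦_⟧ M t ρ
      ⟦renameTerm⟧ e (var x) = lookup≡ e x
      ⟦renameTerm⟧ e (app F ts) = cong (fun F) (⟦renameTerms⟧ e ts)

      ⟦renameTerms⟧ : ∀ {Γ Δ ss} {r : Renaming Γ Δ} {ρ ρ′} → ρ′ ↾ r ≗ ρ →
                      (ts : All (Term L Γ) ss) → ⟦_⟧* M (renameTerms r ts) ρ′ ≡ ⟦_⟧* M ts ρ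
      ⟦renameTerms⟧ e [] = refl
      ⟦renameTerms⟧ e (t ∷ ts) = cong₂ _∷_ (⟦renameTerm⟧ e t) (⟦renameTerms⟧ e ts)

    Sat-rename : ∀ {Γ Δ} {r : Renaming Γ Δ} {ρ ρ′} → ρ′ ↾ r ≗ ρ →
                 (φ : Formula L Γ) → Sat M (rename r φ) ρ′ ⇔ Sat M φ ρ
    Sat-rename e (eq t u) rewrite ⟦renameTerm⟧ e t | ⟦renameTerm⟧ e u = mk⇔ id id
    Sat-rename e (atom R ts) rewrite ⟦renameTerms⟧ e ts = mk⇔ id id
    Sat-rename e bot = mk⇔ id id
    Sat-rename e (and φ ψ) = mk⇔
      (λ (p , q) → to (Sat-rename e φ) p , to (Sat-rename e ψ) q)
      (λ (p , q) → from (Sat-rename e φ) p , from (Sat-rename e ψ) q)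
    Sat-rename e (or φ ψ) = mk⇔
      (Sum.map (to (Sat-rename e φ)) (to (Sat-rename e ψ)))
      (Sum.map (from (Sat-rename e φ)) (from (Sat-rename e ψ)))
    Sat-rename e (impl φ ψ) = mk⇔
      (λ h → to (Sat-rename e ψ) ∘ h ∘ from (Sat-rename e φ))
      (λ h → from (Sat-rename e ψ) ∘ h ∘ to (Sat-rename e φ))
    Sat-rename e (all s φ) = mk⇔
      (λ h m → to (Sat-rename (weaken-≗ e m) φ) (h m))
      (λ h m → from (Sat-rename (weaken-≗ e m) φ) (h m))
    Sat-rename e (ex s φ) = mk⇔
      (λ (m , h) → m , to (Sat-rename (weaken-≗ e m) φ) h)
      (λ (m , h) → m , from (Sat-rename (weaken-≗ e m) φ) h)

    conjunction⁺ : ∀ {Γ} {φs : List (Formula L Γ)} {ρ} →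
                   All (λ φ → Sat M φ ρ) φs → Sat M (conjunction φs) ρ
    conjunction⁺ [] = id
    conjunction⁺ (p ∷ ps) = p , conjunction⁺ ps

    conjunction⁻ : ∀ {Γ} (φs : List (Formula L Γ)) {ρ} →
                   Sat M (conjunction φs) ρ → All (λ φ → Sat M φ ρ) φs
    conjunction⁻ [] _ = []
    conjunction⁻ (φ ∷ φs) (p , ps) = p ∷ conjunction⁻ φs ps

  module _ (em : ExcludedMiddle ℓ) (M : Structure L ℓ) {κ : Set ℓ} (saturated : Saturated M κ)
           {I : S → Set ℓ} (I≺κ : Σ S I ≺ κ)
           (A : ∀ {s} → I s → Structure.Carrier M s) {Δ : List S} where
    open Structure M

    private
      Holds : All Carrier Δ → FormulaOver M I Δ → Set ℓ
      Holds = SatOver M A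

      negOver : FormulaOver M I Δ → FormulaOver M I Δ
      negOver (Γ , φ , is) = Γ , neg φ , is

    module _ {J K : Set ℓ} (φ : J → FormulaOver M I Δ) (χ : K → FormulaOver M I Δ) where

      private
        Bounds : List J → List K → Set ℓ
        Bounds js ks = ∀ ρ → All (Holds ρ ∘ φ) js → Any (Holds ρ ∘ χ) ks

        Φ : Pred (FormulaOver M I Δ) ℓ
        Φ ψ = (∃[ j ] φ j ≡ ψ) ⊎ (∃[ k ] negOver (χ k) ≡ ψ)

        indices : ∀ {ψs} → All Φ ψs → Σ[ js ∈ List J ] Σ[ ks ∈ List K ] (∀ ρ →
                  All (Holds ρ ∘ φ) js → ¬ Any (Holds ρ ∘ χ) ks → All (Holds ρ) ψs)
        indices [] = [] , [] , λ _ _ _ → []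
        indices (inj₁ (j , refl) ∷ ps) with indices ps
        ... | js , ks , h = j ∷ js , ks , λ { ρ (q ∷ qs) ¬χ → q ∷ h ρ qs ¬χ }
        indices (inj₂ (k , refl) ∷ ps) with indices ps
        ... | js , ks , h = js , k ∷ ks , λ ρ qs ¬χ →
          (λ p → contradiction (here p) ¬χ) ∷ h ρ qs (¬χ ∘ there)

      -- If no finite `js` and `ks` sufficed, all `φ j` together with the negations of all `χ k`
      -- would be finitely satisfiable, and saturation would realise them at once, against `φ⇒χ`.
      compactness : (∀ ρ → (∀ j → Holds ρ (φ j)) → ∃[ k ] Holds ρ (χ k)) →
                    Σ[ js ∈ List J ] Σ[ ks ∈ List K ] Bounds js ks
      compactness φ⇒χ with em {Σ[ js ∈ List J ] Σ[ ks ∈ List K ] Bounds js ks}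
      ... | yes bounds = bounds
      ... | no ¬bounds with saturated I I≺κ A Δ Φ finitelySatisfiable
        where
        finitelySatisfiable : ∀ ψs → All Φ ψs → Σ[ ρ ∈ All Carrier Δ ] All (Holds ρ) ψs
        finitelySatisfiable ψs ps with indices ps
        ... | js , ks , h = decidable-stable em λ ¬sat → ¬bounds (js , ks , λ ρ qs →
          decidable-stable em λ ¬χ → ¬sat (ρ , h ρ qs ¬χ))
      ...   | ρ , p with φ⇒χ ρ (λ j → p (φ j) (inj₁ (j , refl)))
      ...     | k , q = contradiction q (lower ∘ p (negOver (χ k)) (inj₂ (k , refl)))

≺-resp-↣ : ∀ {a b c} {A : Set a} {B : Set b} {C : Set c} → A ↣ B → B ≺ C → A ≺ C
≺-resp-↣ f (g , ¬h) = g ↣-∘ f , λ h → ¬h (f ↣-∘ h)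

-- Transfer to the monster model

-- The recursion runs parallel to that of `differs`, so that `Any` over this list matches the
-- disjunction there.
range : ℕ → ℤ → List ℤ
range zero k = k ∷ []
range (suc n) k = k ∷ range n (k ℤ.+ ℤ.1ℤ)

∈-range : ∀ {n i} k → i ℕ.≤ n → k ℤ.+ + i ∈ range n k
∈-range {zero} k ℕ.z≤n = here (ℤ.+-identityʳ k)
∈-range {suc n} k ℕ.z≤n = here (ℤ.+-identityʳ k)
∈-range {suc n} {suc i} k (ℕ.s≤s i≤n) =
  there (subst (_∈ range n (k ℤ.+ ℤ.1ℤ)) (ℤ.+-assoc k ℤ.1ℤ (+ i)) (∈-range (k ℤ.+ ℤ.1ℤ) i≤n))

errors : ℕ → List ℤ
errors C = range (C ℕ.+ C) (ℤ.- + C)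

∈-errors : ∀ {C} z → ∣ z ∣ ℕ.≤ C → z ∈ errors C
∈-errors {C} (+ m) m≤C =
  subst (_∈ errors C) (lemma (+ m) (+ C)) (∈-range (ℤ.- + C) (ℕ.+-monoʳ-≤ C m≤C))
  where
  lemma : ∀ m c → ℤ.- c ℤ.+ (c ℤ.+ m) ≡ m
  lemma = ℤ-Solver.solve-∀
∈-errors {C} -[1+ m ] m<C =
  subst (_∈ errors C) (begin
    ℤ.- + C ℤ.+ + (C ℕ.∸ suc m)  ≡⟨ cong (ℤ._+_ (ℤ.- + C)) (ℤ.⊖-≥ m<C) ⟨
    ℤ.- + C ℤ.+ (C ℤ.⊖ suc m)    ≡⟨ cong (ℤ._+_ (ℤ.- + C)) (ℤ.[+m]-[+n]≡m⊖n C (suc m)) ⟨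
    ℤ.- + C ℤ.+ (+ C ℤ.- + suc m) ≡⟨ lemma (+ C) (+ suc m) ⟩
    -[1+ m ] ∎)
  (∈-range (ℤ.- + C) (ℕ.≤-trans (ℕ.m∸n≤m C (suc m)) (ℕ.m≤m+n C C)))
  where
  open ≡-Reasoning
  lemma : ∀ c m → ℤ.- c ℤ.+ (c ℤ.- m) ≡ ℤ.- m
  lemma = ℤ-Solver.solve-∀

bound : List ℤ → ℕ
bound zs = max 0 (map ∣_∣ zs)

∈⇒≤bound : ∀ {z} zs → z ∈ zs → ∣ z ∣ ℕ.≤ bound zs
∈⇒≤bound zs z∈zs = All.lookup (xs≤max 0 (map ∣_∣ zs)) (∈-map⁺ ∣_∣ z∈zs)

module Transfer {ℓ : Level} {f : 𝔽₂ → ℤ} {L : Language Sort ℓ} {E : Interpretation L ⟦Sort⟧}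
                (M* : Structure (baseLanguage ∪ᴸ L) ℓ) (M≼M* : expansion f E ≼ M*) where

  open Structure M*
  open _≼_ M≼M*
  open Extension M* M≼M*
  open Equivalence

  private
    L⁺ : Language Sort ℓ
    L⁺ = baseLanguage ∪ᴸ L

    M : Structure L⁺ 0ℓ
    M = expansion f E

  infixl 7 _∙_ _⊙_
  infixl 6 _⊹_ _⊕_

  _∙_ : Carrier 𝐅 → Carrier 𝐅 → Carrier 𝐅
  u ∙ v = fun (inj₁ mul) (u ∷ v ∷ [])

  _⊹_ : Carrier 𝐙 → Carrier 𝐙 → Carrier 𝐙
  x ⊹ y = fun (inj₁ add) (x ∷ y ∷ [])

  _⊙_ : ∀ {Γ} → Term L⁺ Γ 𝐅 → Term L⁺ Γ 𝐅 → Term L⁺ Γ 𝐅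
  t ⊙ u = app (inj₁ mul) (t ∷ u ∷ [])

  _⊕_ : ∀ {Γ} → Term L⁺ Γ 𝐙 → Term L⁺ Γ 𝐙 → Term L⁺ Γ 𝐙
  t ⊕ u = app (inj₁ add) (t ∷ u ∷ [])

  fᵗ : ∀ {Γ} → Term L⁺ Γ 𝐅 → Term L⁺ Γ 𝐙
  fᵗ t = app (inj₁ fn) (t ∷ [])

  v₀ : ∀ {s Γ} → Term L⁺ (s ∷ Γ) s
  v₀ = var (here refl)

  v₁ : ∀ {s s₀ Γ} → Term L⁺ (s₀ ∷ s ∷ Γ) s
  v₁ = var (there (here refl))

  v₂ : ∀ {s s₀ s₁ Γ} → Term L⁺ (s₀ ∷ s₁ ∷ s ∷ Γ) s
  v₂ = var (there (there (here refl)))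

  v₃ : ∀ {s s₀ s₁ s₂ Γ} → Term L⁺ (s₀ ∷ s₁ ∷ s₂ ∷ s ∷ Γ) s
  v₃ = var (there (there (there (here refl))))

  v₄ : ∀ {s s₀ s₁ s₂ s₃ Γ} → Term L⁺ (s₀ ∷ s₁ ∷ s₂ ∷ s₃ ∷ s ∷ Γ) s
  v₄ = var (there (there (there (there (here refl)))))

  v₅ : ∀ {s s₀ s₁ s₂ s₃ s₄ Γ} → Term L⁺ (s₀ ∷ s₁ ∷ s₂ ∷ s₃ ∷ s₄ ∷ s ∷ Γ) s
  v₅ = var (there (there (there (there (there (here refl))))))

  v₆ : ∀ {s s₀ s₁ s₂ s₃ s₄ s₅ Γ} → Term L⁺ (s₀ ∷ s₁ ∷ s₂ ∷ s₃ ∷ s₄ ∷ s₅ ∷ s ∷ Γ) s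
  v₆ = var (there (there (there (there (there (there (here refl)))))))

  -- The laws of `𝔽₂*` and `ℤ*` come from the standard structure in this way; the entries of `ρ`
  -- serve as names for standard elements.
  transfer : ∀ {Γ} (φ : Formula L⁺ Γ) (ρ : All ⟦Sort⟧ Γ) →
             Sat M φ ρ → Sat M* φ (All.map embed ρ)
  transfer φ ρ = to (elementary φ ρ)

  embed-· : ∀ u v → embed (u · v) ≡ embed u ∙ embed v
  embed-· u v = transfer (eq v₀ (v₁ ⊙ v₂)) (u · v ∷ u ∷ v ∷ []) refl

  embed-+ : ∀ x y → embed (x ℤ.+ y) ≡ embed x ⊹ embed y
  embed-+ x y = transfer (eq v₀ (v₁ ⊕ v₂)) (x ℤ.+ y ∷ x ∷ y ∷ []) refl

  embed-f : ∀ u → embed (f u) ≡ f* (embed u)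
  embed-f u = transfer (eq v₀ (fᵗ v₁)) (f u ∷ u ∷ []) refl

  embed-injective : ∀ {x y : ℤ} → embed {𝐙} x ≡ embed y → x ≡ y
  embed-injective {x} {y} = from (elementary (eq v₀ v₁) (x ∷ y ∷ []))

  ∙-identityˡ : ∀ u → embed 1𝔽 ∙ u ≡ u
  ∙-identityˡ = transfer (all 𝐅 (eq (v₁ ⊙ v₀) v₀)) (1𝔽 ∷ []) λ _ → refl

  ⊹-identityʳ : ∀ x → x ⊹ embed 0ℤ ≡ x
  ⊹-identityʳ = transfer (all 𝐙 (eq (v₀ ⊕ v₁) v₀)) (0ℤ ∷ []) ℤ.+-identityʳ

  ⊹-divides : ∀ x y → ∃[ z ] x ⊹ z ≡ y
  ⊹-divides = transfer (all 𝐙 (all 𝐙 (ex 𝐙 (eq (v₂ ⊕ v₀) v₁)))) []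
    λ x y → y ℤ.- x , lemma x y
    where
    lemma : ∀ x y → x ℤ.+ (y ℤ.- x) ≡ y
    lemma = ℤ-Solver.solve-∀

  ∙-cancel : ∀ v r d d′ → r ∙ d ∙ embed v ≡ r ∙ d′ → d ∙ embed v ≡ d′
  ∙-cancel v = transfer
    (all 𝐅 (all 𝐅 (all 𝐅 (impl (eq (v₂ ⊙ v₁ ⊙ v₃) (v₂ ⊙ v₀)) (eq (v₁ ⊙ v₃) v₀))))) (v ∷ [])
    λ r d d′ rdv≡rd′ →
      ∙-cancelˡ r (d · v) d′ (trans (sym (·-assoc r d v)) rdv≡rd′)
    where open GroupProperties 𝔽₂-group

  -- With no inverse operation in the language, the inverse arrives as an existential witness that
  -- also solves `g ∙ x ≡ h` for `x`.
  ∙-quotient : ∀ g h x → g ∙ x ≡ h →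
    ∃[ g⁻¹ ] (g ∙ g⁻¹ ≡ embed 1𝔽 × g⁻¹ ∙ g ≡ embed 1𝔽) × g⁻¹ ∙ h ≡ x
  ∙-quotient = transfer
    (all 𝐅 (all 𝐅 (all 𝐅 (impl (eq (v₂ ⊙ v₀) v₁)
      (ex 𝐅 (and (and (eq (v₃ ⊙ v₀) v₄) (eq (v₀ ⊙ v₃) v₄)) (eq (v₀ ⊙ v₂) v₁))))))) (1𝔽 ∷ [])
    λ { g _ x refl → inv g , (inv-inverseʳ g , inv-inverseˡ g) , \\-leftDividesʳ g x }
    where open GroupProperties 𝔽₂-group

  ⊹-quotient : ∀ g h x → g ⊹ x ≡ h →
    ∃[ g⁻¹ ] (g ⊹ g⁻¹ ≡ embed 0ℤ × g⁻¹ ⊹ g ≡ embed 0ℤ) × g⁻¹ ⊹ h ≡ x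
  ⊹-quotient = transfer
    (all 𝐙 (all 𝐙 (all 𝐙 (impl (eq (v₂ ⊕ v₀) v₁)
      (ex 𝐙 (and (and (eq (v₃ ⊕ v₀) v₄) (eq (v₀ ⊕ v₃) v₄)) (eq (v₀ ⊕ v₂) v₁))))))) (0ℤ ∷ [])
    λ { g _ x refl → ℤ.- g , (ℤ.+-inverseʳ g , ℤ.+-inverseˡ g) , \\-leftDividesʳ g x }
    where open GroupProperties (AbelianGroup.group ℤ.+-0-abelianGroup)

  quotient-closed : ∀ {K : Subset} → IsSubgroup K → ∀ {g h u v x y} →
                    K (u , x) → K (v , y) → u ∙ g ≡ v → x ⊹ h ≡ y → K (g , h)
  quotient-closed {K} K-subgroup {g} {h} {u} {v} {x} {y} Kux Kvy ug≡v xh≡y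
    with ∙-quotient u v g ug≡v | ⊹-quotient x y h xh≡y
  ... | u⁻¹ , (uu⁻¹ , u⁻¹u) , refl | x⁻¹ , (xx⁻¹ , x⁻¹x) , refl =
    ∙-closed (⁻¹-closed Kux ((uu⁻¹ , xx⁻¹) , (u⁻¹u , x⁻¹x))) Kvy
    where open IsSubgroup K-subgroup

  -- x = k + y for some k in t, t + e, …, t + n e.
  differs : ∀ {Γ} → ℕ → (e t x y : Term L⁺ Γ 𝐙) → Formula L⁺ Γ
  differs zero e t x y = eq x (t ⊕ y)
  differs (suc n) e t x y = or (eq x (t ⊕ y)) (differs n e (t ⊕ e) x y)

  differs⁺ : ∀ {Γ} n {e t x y : Term L⁺ Γ 𝐙} {ρ k} → ⟦_⟧ M e ρ ≡ ℤ.1ℤ → ⟦_⟧ M t ρ ≡ k →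
             Any (λ c → ⟦_⟧ M x ρ ≡ c ℤ.+ ⟦_⟧ M y ρ) (range n k) → Sat M (differs n e t x y) ρ
  differs⁺ zero e≡1 refl (here p) = p
  differs⁺ (suc n) e≡1 refl (here p) = inj₁ p
  differs⁺ (suc n) {t = t} {ρ = ρ} e≡1 refl (there p) =
    inj₂ (differs⁺ n e≡1 (cong (ℤ._+_ (⟦_⟧ M t ρ)) e≡1) p)

  differs⁻ : ∀ {Γ} n {e t x y : Term L⁺ Γ 𝐙} {ρ k} →
             ⟦_⟧ M* e ρ ≡ embed ℤ.1ℤ → ⟦_⟧ M* t ρ ≡ embed k → Sat M* (differs n e t x y) ρ →
             Any (λ c → ⟦_⟧ M* x ρ ≡ embed c ⊹ ⟦_⟧ M* y ρ) (range n k)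
  differs⁻ zero {y = y} {ρ} e≡1 t≡k p = here (trans p (cong (_⊹ ⟦_⟧ M* y ρ) t≡k))
  differs⁻ (suc n) {y = y} {ρ} e≡1 t≡k (inj₁ p) = here (trans p (cong (_⊹ ⟦_⟧ M* y ρ) t≡k))
  differs⁻ (suc n) {k = k} e≡1 t≡k (inj₂ p) =
    there (differs⁻ n e≡1 (trans (cong₂ _⊹_ t≡k e≡1) (sym (embed-+ k ℤ.1ℤ))) p)

  -- The graph of `f*` and the subgroup generated by it

  module _ (f-inverse : ∀ u v → u · v ≡ 1𝔽 → f v ≡ ℤ.- f u) where

    f-1≡0 : f 1𝔽 ≡ 0ℤ
    f-1≡0 = i≡-i⇒i≡0 (f-inverse 1𝔽 1𝔽 refl)

    X-symmetric : Symmetric X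
    X-symmetric {u , _} {v , y} refl ((uv≡1 , x+y≡0) , _) = transfer
      (all 𝐅 (all 𝐅 (all 𝐙 (impl (eq (v₂ ⊙ v₁) v₃) (impl (eq (fᵗ v₂ ⊕ v₀) v₄) (eq (fᵗ v₁) v₀))))))
      (1𝔽 ∷ 0ℤ ∷ [])
      (λ u v y uv≡1 fu+y≡0 → trans (f-inverse u v uv≡1)
        (sym (inverseʳ-unique (f u) y fu+y≡0)))
      u v y uv≡1 x+y≡0
      where open GroupProperties (AbelianGroup.group ℤ.+-0-abelianGroup)

    module _ {C : ℕ} (f-quasi : ∀ u v → ∣ f u ℤ.+ f v ℤ.- f (u · v) ∣ ℕ.≤ C) where

      -- A bounded integer error is a finite disjunction, hence a first-order condition, so in `M*`
      -- the error is still one of the same standard integers.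
      f*-quasi : ∀ u v → Any (λ c → f* u ⊹ f* v ≡ embed c ⊹ f* (u ∙ v)) (errors C)
      f*-quasi u v = differs⁻ (C ℕ.+ C) {v₂} {v₃} {fᵗ v₁ ⊕ fᵗ v₀} {fᵗ (v₁ ⊙ v₀)}
        {v ∷ u ∷ embed ℤ.1ℤ ∷ embed (ℤ.- + C) ∷ []} refl refl
        (transfer
          (all 𝐅 (all 𝐅 (differs (C ℕ.+ C) v₂ v₃ (fᵗ v₁ ⊕ fᵗ v₀) (fᵗ (v₁ ⊙ v₀)))))
          (ℤ.1ℤ ∷ ℤ.- + C ∷ [])
          (λ u v → differs⁺ (C ℕ.+ C) {v₂} {v₃} {fᵗ v₁ ⊕ fᵗ v₀} {fᵗ (v₁ ⊙ v₀)}
            {v ∷ u ∷ ℤ.1ℤ ∷ ℤ.- + C ∷ []} refl refl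
            (Any.map (λ { refl → lemma (f u ℤ.+ f v) (f (u · v)) })
              (∈-errors (f u ℤ.+ f v ℤ.- f (u · v)) (f-quasi u v))))
          u v)
        where
        lemma : ∀ s t → s ≡ (s ℤ.- t) ℤ.+ t
        lemma = ℤ-Solver.solve-∀

      -- One translate, by `(1 , c)`, suffices for each possible error `c`.
      X-approximate : IsApproximateSubgroup X
      X-approximate = X-symmetric , map (λ c → embed 1𝔽 , embed c) (errors C) ,
        λ { {u , _} {v , _} refl refl → Any.map⁺ (Any.map
          (λ p → (u ∙ v , f* (u ∙ v)) , refl , sym (∙-identityˡ (u ∙ v)) , p) (f*-quasi u v)) }

      Near : Subset
      Near (u , x) = ∃[ k ] x ≡ f* u ⊹ embed k

      -- Induction on the generation of `H`: a product adds one error from a finite list of standard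
      -- integers, and an inverse changes the sign of `k` because `f` is odd.
      H⊆Near : H ⊆ Near
      H⊆Near {u , _} (incl refl) = 0ℤ , sym (⊹-identityʳ (f* u))
      H⊆Near unit = 0ℤ , transfer (eq v₀ (fᵗ v₁ ⊕ v₀)) (0ℤ ∷ 1𝔽 ∷ [])
        (sym (cong (ℤ._+ 0ℤ) f-1≡0))
      H⊆Near (product {u , _} {v , _} p q) with H⊆Near p | H⊆Near q | satisfied (f*-quasi u v)
      ... | k , refl | l , refl | c , fu+fv≡ = c ℤ.+ (k ℤ.+ l) , transfer
        (all 𝐅 (all 𝐅 (impl (eq (fᵗ v₁ ⊕ fᵗ v₀) (v₂ ⊕ fᵗ (v₁ ⊙ v₀)))
          (eq (fᵗ v₁ ⊕ v₃ ⊕ (fᵗ v₀ ⊕ v₄)) (fᵗ (v₁ ⊙ v₀) ⊕ v₅)))))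
        (c ∷ k ∷ l ∷ c ℤ.+ (k ℤ.+ l) ∷ [])
        (λ u v fu+fv≡ → trans (lemma (f u) (f v) k l)
          (trans (cong (ℤ._+ (k ℤ.+ l)) fu+fv≡) (lemma′ c (f (u · v)) (k ℤ.+ l))))
        u v fu+fv≡
        where
        lemma : ∀ s t k l → s ℤ.+ k ℤ.+ (t ℤ.+ l) ≡ (s ℤ.+ t) ℤ.+ (k ℤ.+ l)
        lemma = ℤ-Solver.solve-∀
        lemma′ : ∀ c w m → c ℤ.+ w ℤ.+ m ≡ w ℤ.+ (c ℤ.+ m)
        lemma′ = ℤ-Solver.solve-∀
      H⊆Near (inverse {u , _} {v , y} p ((uv≡1 , x+y≡0) , _)) with H⊆Near p
      ... | k , refl = ℤ.- k , transfer
        (all 𝐅 (all 𝐅 (all 𝐙 (impl (eq (v₂ ⊙ v₁) v₃) (impl (eq (fᵗ v₂ ⊕ v₅ ⊕ v₀) v₄)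
          (eq v₀ (fᵗ v₁ ⊕ v₆)))))))
        (1𝔽 ∷ 0ℤ ∷ k ∷ ℤ.- k ∷ [])
        (λ u v y uv≡1 x+y≡0 → trans (inverseʳ-unique (f u ℤ.+ k) y x+y≡0)
          (trans (ℤ.neg-distrib-+ (f u) k) (cong (ℤ._- k) (sym (f-inverse u v uv≡1)))))
        u v y uv≡1 x+y≡0
        where open GroupProperties (AbelianGroup.group ℤ.+-0-abelianGroup)

-- Type-definable subgroups of bounded index

module _ {α β : ℤ → ℤ} (α-bounded : Bounded α) (β-bounded : Bounded β)
         (α-odd : Odd α) (β-odd : Odd β) (f : 𝔽₂ → ℤ) (f-given : GivenBy α β f) where

  open Values α β α-odd β-odd f f-given
  open RunSum φ φ-odd

  private
    B : ℕ
    B = proj₁ α-bounded ℕ.+ proj₁ β-bounded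

    φ-bounded : ∀ g n → ∣ φ g n ∣ ℕ.≤ B
    φ-bounded a n = ℕ.≤-trans (proj₂ α-bounded n) (ℕ.m≤m+n _ _)
    φ-bounded b n = ℕ.≤-trans (proj₂ β-bounded n) (ℕ.m≤n+m _ _)

  f-quasimorphism : ∃[ C ] (∀ u v → ∣ f u ℤ.+ f v ℤ.- f (u · v) ∣ ℕ.≤ C)
  f-quasimorphism = _ , λ u v → subst (λ z → ∣ z ∣ ℕ.≤ _)
    (sym (cong₂ ℤ._-_ (cong₂ ℤ._+_ (f≡runSum u) (f≡runSum v)) (f≡runSum (u · v))))
    (runSum-· φ-bounded u v)

-- The standard integers as a small set of parameters

ℤ-parameters : (ℓ : Level) → Sort → Set ℓ
ℤ-parameters ℓ 𝐅 = Lift ℓ ⊥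
ℤ-parameters ℓ 𝐙 = Lift ℓ ℤ

-- As `κ` exceeds the number of formulas, it is enough to code integers by formulas: the length of
-- the context carries the natural number, the choice of formula the sign.
ℤ-parameters↣Formulas : ∀ {ℓ} (L : Language Sort ℓ) →
                        Σ Sort (ℤ-parameters ℓ) ↣ (Σ[ Γ ∈ List Sort ] Formula L Γ)
ℤ-parameters↣Formulas L = mk↣ {to = code} (code-injective _ _)
  where
  code : Σ Sort (ℤ-parameters _) → Σ[ Γ ∈ List Sort ] Formula L Γ
  code (𝐙 , lift (+ n)) = replicate n 𝐅 , bot
  code (𝐙 , lift -[1+ n ]) = replicate n 𝐅 , and bot bot

  replicate-injective : ∀ m n → replicate m 𝐅 ≡ replicate n 𝐅 → m ≡ n
  replicate-injective m n p =
    trans (sym (length-replicate m)) (trans (cong length p) (length-replicate n))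

  isBot : Σ[ Γ ∈ List Sort ] Formula L Γ → Set
  isBot (_ , bot) = ⊤
  isBot _ = ⊥

  code-injective : ∀ x y → code x ≡ code y → x ≡ y
  code-injective (𝐙 , lift (+ m)) (𝐙 , lift (+ n)) p =
    cong (λ k → 𝐙 , lift (+ k)) (replicate-injective m n (cong proj₁ p))
  code-injective (𝐙 , lift -[1+ m ]) (𝐙 , lift -[1+ n ]) p =
    cong (λ k → 𝐙 , lift -[1+ k ]) (replicate-injective m n (cong proj₁ p))
  code-injective (𝐙 , lift (+ m)) (𝐙 , lift -[1+ n ]) p = contradiction (subst isBot p tt) id
  code-injective (𝐙 , lift -[1+ m ]) (𝐙 , lift (+ n)) p = contradiction (subst isBot (sym p) tt) id

<⇒+≢0 : ∀ {m n} → m ℕ.< n → + n ≢ 0ℤ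
<⇒+≢0 (ℕ.s≤s _) ()

module TypeDefinableSubgroup
  {ℓ : Level} (em : ExcludedMiddle ℓ) {f : 𝔽₂ → ℤ}
  {L : Language Sort ℓ} {E : Interpretation L ⟦Sort⟧}
  (M* : Structure (baseLanguage ∪ᴸ L) ℓ) (M≼M* : expansion f E ≼ M*)
  {κ : Set ℓ} (monster : IsMonster M* κ)
  where

  open Structure M*
  open _≼_ M≼M*
  open Extension M* M≼M*
  open Transfer M* M≼M*
  open IsMonster monster
  open Equivalence

  private
    L⁺ : Language Sort ℓ
    L⁺ = baseLanguage ∪ᴸ L

    pair : List Sort
    pair = 𝐅 ∷ 𝐙 ∷ []

    ℤ-small : Σ Sort (ℤ-parameters ℓ) ≺ κ
    ℤ-small = ≺-resp-↣ (ℤ-parameters↣Formulas L⁺) large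

    ℤ-constants : ∀ {s} → ℤ-parameters ℓ s → Carrier s
    ℤ-constants {𝐙} (lift k) = embed k

  module Neighbourhoods
    {K : Subset} {Φ : Pred (Formula L⁺ pair) ℓ}
    (K≐Φ : asTuples K ≐ λ ρ → ∀ φ → Φ φ → Sat M* φ ρ)
    (K-subgroup : IsSubgroup K)
    where

    open IsSubgroup K-subgroup

    K⇒Φ : ∀ {u x} → K (u , x) → ∀ φ → Φ φ → Sat M* φ (u ∷ x ∷ [])
    K⇒Φ {u} {x} = proj₁ K≐Φ {u ∷ x ∷ []}

    Φ⇒K : ∀ {u x} → (∀ φ → Φ φ → Sat M* φ (u ∷ x ∷ [])) → K (u , x)
    Φ⇒K {u} {x} = proj₂ K≐Φ {u ∷ x ∷ []}

    _⊇K : Formula L⁺ pair → Set ℓ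
    D ⊇K = ∀ {u x} → K (u , x) → Sat M* D (u ∷ x ∷ [])

    conjunction⊇K : (js : List (∃[ φ ] Φ φ)) → conjunction (map proj₁ js) ⊇K
    conjunction⊇K js {u} {x} Kux =
      conjunction⁺ M* (All.map⁺ (All.universal (λ (φ , Φφ) → K⇒Φ Kux φ Φφ) js))

    abstract
      -- `K` is covered by definable sets, one for each standard integer `k`. By compactness,
      -- finitely many of the formulas that define `K` already imply membership in one of finitely
      -- many such sets.
      neighbourhood : (∀ {u x} → K (u , x) → ∃[ k ] x ≡ f* u ⊹ embed k) →
        Σ[ D ∈ Formula L⁺ pair ] D ⊇K × (Σ[ ks ∈ List ℤ ] (∀ {u x} →
          Sat M* D (u ∷ x ∷ []) → ∃[ k ] k ∈ ks × x ≡ f* u ⊹ embed k))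
      neighbourhood K⊆Near with compactness em M* saturated ℤ-small ℤ-constants {pair}
        {∃[ φ ] Φ φ} {Lift ℓ ℤ}
        (λ (φ , _) → [] , φ , [])
        -- The variable `v₂` is the parameter `k`, which follows the pair in the context.
        (λ k → 𝐙 ∷ [] , eq v₁ (fᵗ v₀ ⊕ v₂) , k ∷ [])
        (λ { (u ∷ x ∷ []) h → let k , x≡ = K⊆Near (Φ⇒K λ φ Φφ → h (φ , Φφ)) in lift k , x≡ })
      ... | js , ks , bounds = conjunction (map proj₁ js) , conjunction⊇K js ,
        map lower ks , λ {u} {x} Dux →
          let k∈ = bounds (u ∷ x ∷ []) (All.map⁻ (conjunction⁻ M* (map proj₁ js) Dux))
              k , k∈ks , x≡ = find k∈
          in lower k , ∈-map⁺ lower k∈ks , x≡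

    -- The inclusion of `D′`⁻¹`D′` in `D`, with quotients given by equations so that the language
    -- can express it.
    QuotientsIn : Formula L⁺ pair → Formula L⁺ pair → Set ℓ
    QuotientsIn D D′ = ∀ {g h u v x y} → Sat M* D′ (u ∷ x ∷ []) → Sat M* D′ (v ∷ y ∷ []) →
      u ∙ g ≡ v → x ⊹ h ≡ y → Sat M* D (g ∷ h ∷ [])

    first : ∀ {Γ} → Renaming {L = L⁺} pair (𝐅 ∷ 𝐙 ∷ Γ)
    first (here p) = here p
    first (there (here p)) = there (here p)

    Sat-first : ∀ {Γ u x} {ρ : All Carrier Γ} (φ : Formula L⁺ pair) →
                Sat M* (rename first φ) (u ∷ x ∷ ρ) ⇔ Sat M* φ (u ∷ x ∷ [])
    Sat-first = Sat-rename M* (pointwise λ { (here refl) → refl ; (there (here refl)) → refl })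

    second : ∀ {Γ} → Renaming {L = L⁺} pair (𝐅 ∷ 𝐙 ∷ 𝐅 ∷ 𝐙 ∷ Γ)
    second x = there (there (first x))

    Sat-second : ∀ {Γ u x v y} {ρ : All Carrier Γ} (φ : Formula L⁺ pair) →
                 Sat M* (rename second φ) (u ∷ x ∷ v ∷ y ∷ ρ) ⇔ Sat M* φ (v ∷ y ∷ [])
    Sat-second = Sat-rename M* (pointwise λ { (here refl) → refl ; (there (here refl)) → refl })

    abstract
      -- Two points that satisfy all of `Φ` lie in `K`, hence so does their quotient, which then
      -- satisfies `D`. Compactness for pairs of points finds a finite part of `Φ` with the same
      -- effect.
      quotient-root : ∀ D → D ⊇K → Σ[ D′ ∈ Formula L⁺ pair ] D′ ⊇K × QuotientsIn D D′
      quotient-root D D⊇K with compactness em M* saturated ℤ-small ℤ-constants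
        {𝐅 ∷ 𝐙 ∷ 𝐅 ∷ 𝐙 ∷ []} {∃[ φ ] Φ φ} {Lift ℓ ⊤}
        (λ (φ , _) → [] , and (rename first φ) (rename second φ) , [])
        (λ _ → [] ,
          all 𝐙 (all 𝐅 (impl (eq (v₂ ⊙ v₀) v₄) (impl (eq (v₃ ⊕ v₁) v₅) (rename first D)))) ,
          [])
        (λ { (u ∷ x ∷ v ∷ y ∷ []) h → lift tt , λ z g ug≡v xz≡y → from (Sat-first D)
          (D⊇K (quotient-closed K-subgroup
            (Φ⇒K λ φ Φφ → to (Sat-first φ) (proj₁ (h (φ , Φφ))))
            (Φ⇒K λ φ Φφ → to (Sat-second φ) (proj₂ (h (φ , Φφ))))
            ug≡v xz≡y)) })
      ... | js , _ , bounds = conjunction (map proj₁ js) , conjunction⊇K js ,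
        λ {g} {h} {u} {v} {x} {y} D′ux D′vy ug≡v xh≡y →
          to (Sat-first D) (proj₂ (satisfied (bounds (u ∷ x ∷ v ∷ y ∷ [])
            (All.zipWith (λ { {φ , _} (p , q) → from (Sat-first φ) p , from (Sat-second φ) q })
              ( All.map⁻ (conjunction⁻ M* (map proj₁ js) D′ux)
              , All.map⁻ (conjunction⁻ M* (map proj₁ js) D′vy))))) h g ug≡v xh≡y)

    abstract
      -- Each `u` is the first coordinate of the point `(u , f* u)` of `H`, which lies in a coset of
      -- `K`. The representatives supply fewer than `κ` parameters, so compactness without premises
      -- makes finite the cover by translates of the projection of `D`.
      finite-cover : BoundedIndex κ H K → ∀ D → D ⊇K → Σ[ rs ∈ List (Carrier 𝐅) ]
        (∀ u → Any (λ r → ∃[ t ] ∃[ d ] Sat M* D (d ∷ t ∷ []) × u ≡ r ∙ d) rs)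
      finite-cover (I , I≺κ , r , _ , H⊆rK) D D⊇K with compactness em M* saturated
        (≺-resp-↣ index↣I I≺κ) representative {𝐅 ∷ []} {Lift ℓ ⊥} {I}
        (λ ()) (λ i → 𝐅 ∷ [] , ex 𝐙 (ex 𝐅 (and (rename first D) (eq v₂ (v₃ ⊙ v₀)))) , i ∷ [])
        (λ { (u ∷ []) _ → let i , (d , t) , Kdt , u≡ , _ = H⊆rK (incl {g = u , f* u} refl)
                         in i , t , d , from (Sat-first D) (D⊇K Kdt) , u≡ })
        where
        index : Sort → Set ℓ
        index 𝐅 = I
        index 𝐙 = Lift ℓ ⊥

        index↣I : Σ Sort index ↣ I
        index↣I = mk↣ {to = λ { (𝐅 , i) → i }} λ { {𝐅 , _} {𝐅 , _} refl → refl }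

        representative : ∀ {s} → index s → Carrier s
        representative {𝐅} i = proj₁ (r i)
      ... | js , is , bounds = map (proj₁ ∘ r) is , λ u → Any.map⁺ (Any.map
        (λ (t , d , Ddt , u≡) → t , d , to (Sat-first D) Ddt , u≡)
        (bounds (u ∷ []) (All.universal (λ ()) js)))

    -- The descending chain of definable neighbourhoods of `K`

    module Chain (K⊆Near : ∀ {u x} → K (u , x) → ∃[ k ] x ≡ f* u ⊹ embed k)
                 (K-bounded : BoundedIndex κ H K) where

      D : ℕ → Σ[ D ∈ Formula L⁺ pair ] D ⊇K
      D zero = let D₀ , D₀⊇K , _ = neighbourhood K⊆Near in D₀ , D₀⊇K
      D (suc i) =
        let Dᵢ , Dᵢ⊇K = D i
            D′ , D′⊇K , _ = quotient-root Dᵢ Dᵢ⊇K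
        -- The conjunct `Dᵢ` makes the chain descend, for `D⊆D₀`.
        in and D′ Dᵢ , λ Kux → D′⊇K Kux , Dᵢ⊇K Kux

      D-quotients : ∀ i → QuotientsIn (proj₁ (D i)) (proj₁ (D (suc i)))
      D-quotients i (p , _) (q , _) = proj₂ (proj₂ (quotient-root (proj₁ (D i)) (proj₂ (D i)))) p q

      D⊆D₀ : ∀ i {ρ} → Sat M* (proj₁ (D i)) ρ → Sat M* (proj₁ (D 0)) ρ
      D⊆D₀ zero p = p
      D⊆D₀ (suc i) (_ , p) = D⊆D₀ i p

      errorsOfK : List ℤ
      errorsOfK = proj₁ (proj₂ (proj₂ (neighbourhood K⊆Near)))

      D₀-near : ∀ {u x} → Sat M* (proj₁ (D 0)) (u ∷ x ∷ []) → ∃[ k ] k ∈ errorsOfK × x ≡ f* u ⊹ embed k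
      D₀-near = proj₂ (proj₂ (proj₂ (neighbourhood K⊆Near)))

      S : ℕ → 𝔽₂ → ℤ → Set ℓ
      S i u x = Sat M* (proj₁ (D i)) (embed u ∷ embed x ∷ [])

      S-1 : ∀ i → S i 1𝔽 0ℤ
      S-1 i = proj₂ (D i) ε-closed

      S-quotient : ∀ {i u v x y} → S (suc i) u x → S (suc i) v y → S i (inv u · v) (y ℤ.- x)
      S-quotient {i} {u} {v} {x} {y} p q = D-quotients i p q
        (trans (sym (embed-· u (inv u · v))) (cong embed (\\-leftDividesˡ u v)))
        (trans (sym (embed-+ x (y ℤ.- x))) (cong embed (lemma x y)))
        where
        open GroupProperties 𝔽₂-group
        lemma : ∀ x y → x ℤ.+ (y ℤ.- x) ≡ y
        lemma = ℤ-Solver.solve-∀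

      -- For standard points the equation in `M*` pulls back to the integers, and `k` ranges over a
      -- finite list.
      S-near : ∀ {u x} → S 0 u x → ∣ x ℤ.- f u ∣ ℕ.≤ bound errorsOfK
      S-near {u} {x} p =
        let k , k∈ks , x≡ = D₀-near p
            x≡fu+k = embed-injective (trans x≡ (trans
              (cong (_⊹ embed k) (sym (embed-f u))) (sym (embed-+ (f u) k))))
        in subst (λ z → ∣ z ∣ ℕ.≤ bound errorsOfK)
             (trans (lemma (f u) k) (cong (ℤ._- f u) (sym x≡fu+k)))
             (∈⇒≤bound errorsOfK k∈ks)
        where
        lemma : ∀ s k → k ≡ s ℤ.+ k ℤ.- s
        lemma = ℤ-Solver.solve-∀

      -- Two of the elements g^(jP), j ∈ ℕ, lie in the same translate of Dᵢ₊₁.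
      S-contains-power : ∀ i g P → Σ[ p ∈ ℕ ] Σ[ z ∈ ℤ ] P ℕ.≤ p × S i (g ^ (+ p)) z
      S-contains-power i g P
        with finite-cover K-bounded (proj₁ (D (suc i))) (proj₂ (D (suc i)))
      ... | rs , cover
        with Fin.pigeonhole (ℕ.n<1+n (length rs)) (λ j → Any.index (cover (embed (power j))))
        where
        power : Fin.Fin (suc (length rs)) → 𝔽₂
        power j = g ^ (+ (Fin.toℕ j ℕ.* P))
      ... | j , j′ , j<j′ , same
        with Any.lookup-index (cover (embed (g ^ (+ (Fin.toℕ j ℕ.* P)))))
           | Any.lookup-index (cover (embed (g ^ (+ (Fin.toℕ j′ ℕ.* P)))))
      ... | t , d , Ddt , u≡rd | t′ , d′ , Dd′t′ , u′≡r′d′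
        with ⊹-divides t t′
      ... | z , t+z≡t′ = p , f (g ^ (+ p)) ℤ.+ k , P≤p ,
        subst (λ y → Sat M* (proj₁ (D i)) (embed (g ^ (+ p)) ∷ y ∷ [])) z≡ Dgᵖz
        where
        m = Fin.toℕ j
        m′ = Fin.toℕ j′
        p = (m′ ℕ.∸ m) ℕ.* P
        r = List.lookup rs (Any.index (cover (embed (g ^ (+ (m ℕ.* P))))))

        P≤p : P ℕ.≤ p
        P≤p = ℕ.m≤n*m P (m′ ℕ.∸ m) {{ℕ.>-nonZero (ℕ.m<n⇒0<n∸m j<j′)}}

        mP+p : m ℕ.* P ℕ.+ p ≡ m′ ℕ.* P
        mP+p = trans (sym (ℕ.*-distribʳ-+ P m (m′ ℕ.∸ m)))
          (cong (ℕ._* P) (ℕ.m+[n∸m]≡n (ℕ.<⇒≤ j<j′)))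

        dgᵖ≡d′ : d ∙ embed (g ^ (+ p)) ≡ d′
        dgᵖ≡d′ = ∙-cancel (g ^ (+ p)) r d d′ (begin
          r ∙ d ∙ embed (g ^ (+ p))                        ≡⟨ cong (_∙ embed (g ^ (+ p))) u≡rd ⟨
          embed (g ^ (+ (m ℕ.* P))) ∙ embed (g ^ (+ p))    ≡⟨ embed-· _ _ ⟨
          embed (g ^ (+ (m ℕ.* P)) · g ^ (+ p))            ≡⟨ cong embed (^-homo-+ g (m ℕ.* P) p) ⟨
          embed (g ^ (+ (m ℕ.* P ℕ.+ p)))                  ≡⟨ cong (λ n → embed (g ^ (+ n))) mP+p ⟩
          embed (g ^ (+ (m′ ℕ.* P)))                       ≡⟨ u′≡r′d′ ⟩
          List.lookup rs (Any.index (cover (embed (g ^ (+ (m′ ℕ.* P)))))) ∙ d′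
            ≡⟨ cong (λ l → List.lookup rs l ∙ d′) same ⟨
          r ∙ d′                                           ∎)
          where open ≡-Reasoning

        Dgᵖz : Sat M* (proj₁ (D i)) (embed (g ^ (+ p)) ∷ z ∷ [])
        Dgᵖz = D-quotients i Ddt Dd′t′ dgᵖ≡d′ t+z≡t′

        -- A priori `z` is a difference of two possibly nonstandard coordinates; membership in `D₀`
        -- forces it to be standard.
        near = D₀-near (D⊆D₀ i Dgᵖz)
        k = proj₁ near

        z≡ : z ≡ embed (f (g ^ (+ p)) ℤ.+ k)
        z≡ = trans (proj₂ (proj₂ near))
          (trans (cong (_⊹ embed k) (sym (embed-f (g ^ (+ p))))) (sym (embed-+ (f (g ^ (+ p))) k)))

-- The contradiction with the finiteness of the zeros of `α`

corollary5p11 : (∀ ℓ → ExcludedMiddle ℓ) →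
    (α β : ℤ → ℤ) → Bounded α → Bounded β → Odd α → Odd β →
    AlmostNowhereZero α →
    (f : 𝔽₂ → ℤ) → GivenBy α β f →
    ∀ {ℓ} (L : Language Sort ℓ) (E : Interpretation L ⟦Sort⟧)
    (M* : Structure (baseLanguage ∪ᴸ L) ℓ) (M≼M* : expansion f E ≼ M*)
    (κ : Set ℓ) → IsMonster M* κ →
    let open Extension M* M≼M* in
    ∅-Definable M* (asTuples X) × IsApproximateSubgroup X × ¬ H⁰⁰-Exists κ
corollary5p11 em α β α-bounded β-bounded α-odd β-odd (zeros , α-nonzero) f f-given {ℓ} L E
              M* M≼M* κ monster =
  (eq (fᵗ v₀) v₁ , (λ { {u ∷ x ∷ []} p → p }) , λ { {u ∷ x ∷ []} p → p }) ,
  X-approximate f-inverse quasi ,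
  no-H⁰⁰
  where
  open Extension M* M≼M*
  open Transfer M* M≼M*
  open Values α β α-odd β-odd f f-given using (f-inverse)

  quasi = proj₂ (f-quasimorphism α-bounded β-bounded α-odd β-odd f f-given)

  no-H⁰⁰ : ¬ H⁰⁰-Exists κ
  no-H⁰⁰ (K , (Φ , K≐Φ) , K-subgroup , K⊆H , K-bounded) =
    let p , _ , P≤p , Sa = S-contains-power level a P
        q , _ , 1≤q , Sb = S-contains-power level b 1
    in α-nonzero (+ p) (ℕ.<⇒≱ P≤p ∘ ∈⇒≤bound zeros)
         (α-vanishes (<⇒+≢0 P≤p) (<⇒+≢0 1≤q) Sa Sb)
    where
    module T = TypeDefinableSubgroup (em ℓ) M* M≼M* monster
    module N = T.Neighbourhoods K≐Φ K-subgroup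
    open N.Chain (H⊆Near f-inverse quasi ∘ K⊆H) K-bounded
    open NoApproximateHomomorphism α β α-odd β-odd (proj₁ α-bounded) (proj₂ α-bounded) f f-given
      ℓ S S-1 (λ {i} → S-quotient {i}) (bound errorsOfK) S-near

    -- Beyond the absolute value of every entry of `zeros`, so `+ p` is not in that list when
    -- `P ℕ.≤ p`.
    P = suc (bound zeros)
    level = 2 ℕ.+ depth ℕ.* 2
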